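{- The model checking problem for $\mathrm{TeamLTL}(\subseteq,\lor_{\mathsf B})$ is $\Sigma^0_1$-hard.
   Context: LTL formulae over a set $\mathrm{AP}$ of atomic propositions are given in negation normal form: $\varphi ::= p \mid \neg p \mid \varphi\lor\varphi \mid \varphi\land\varphi \mid \mathsf X\varphi \mid \varphi\,\mathsf U\,\varphi \mid \varphi\,\mathsf W\,\varphi$ with $p\in\mathrm{AP}$; $\bot:=p\land\neg p$, $\top:=p\lor\neg p$, $\mathsf F\varphi:=\top\,\mathsf U\,\varphi$, $\mathsf G\varphi:=\varphi\,\mathsf W\,\bot$. A trace is an element of $(2^{\mathrm{AP}})^\omega$, and $t[i]$ is its $i$-th letter. For an LTL formula $\varphi$, $\llbracket\varphi\rrbracket_{(t,i)}\in\{0,1\}$ is its usual LTL truth value on trace $t$ at position $i$. A team is a pair $(T,i)$ with $T\subseteq(2^{\mathrm{AP}})^\omega$ and $i\in\mathbb N$. TeamLTL is LTL with the following (synchronous) team semantics: - $(T,i)\models p$ iff $p\in t[i]$ for all $t\in T$; $(T,i)\models\neg p$ iff $p\notin t[i]$ for all $t\in T$; - $(T,i)\models\varphi\land\psi$ iff $(T,i)\models\varphi$ and $(T,i)\models\psi$; - $(T,i)\models\varphi\lor\psi$ iff there are $T_1,T_2$ with $T_1\cup T_2=T$, $(T_1,i)\models\varphi$ and $(T_2,i)\models\psi$; - $(T,i)\models\mathsf X\varphi$ iff $(T,i+1)\models\varphi$; - $(T,i)\models\varphi\,\mathsf U\,\psi$ iff there is $k\ge i$ with $(T,k)\models\psi$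 and $(T,m)\models\varphi$ for all $i\le m<k$; - $(T,i)\models\varphi\,\mathsf W\,\psi$ iff for all $k\ge i$: $(T,k)\models\varphi$ or there is $m$ with $i\le m\le k$ and $(T,m)\models\psi$. $\mathrm{TeamLTL}(\subseteq,\lor_{\mathsf B})$ additionally allows: - inclusion atoms $\varphi_1,\dots,\varphi_n\subseteq\psi_1,\dots,\psi_n$ with LTL formulae $\varphi_j,\psi_j$: $(T,i)$ satisfies it iff for every $t\in T$ there is $t'\in T$ with $\llbracket\varphi_j\rrbracket_{(t,i)}=\llbracket\psi_j\rrbracket_{(t',i)}$ for all $1\le j\le n$; - Boolean disjunction: $(T,i)\models\varphi\lor_{\mathsf B}\psi$ iff $(T,i)\models\varphi$ or $(T,i)\models\psi$. A Kripke structure is $K=(W,R,\eta,w_0)$ with $W$ a finite set of states, $R\subseteq W^2$, $\eta\colon W\to2^{\mathrm{AP}}$ and $w_0\in W$. A path is $\sigma\in W^\omega$ with $\sigma[0]=w_0$ and $(\sigma[i],\sigma[i+1])\in R$ for all $i$; its trace is $\eta(\sigma[0])\eta(\sigma[1])\cdots$; $\mathrm{Traces}(K)$ is the set of traces of paths of $K$. The model checking problem of a logic $\mathcal L$: given $\varphi\in\mathcal L$ and a Kripke structure $K$, decide whether $(\mathrm{Traces}(K),0)\models\varphi$. Hardness is with respect to computable many-one reductions. -}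

module Defs where

open import Data.Bool.Base using (Bool; true; false; T; if_then_else_)
open import Data.Fin.Base using (Fin; toℕ)
open import Data.Fin.Properties using (toℕ-injective)
open import Data.Fin.Subset using (Subset; _∈_; _∉_)
open import Data.Nat.Base using (ℕ; zero; suc; _+_; _*_; _^_; _≤_; _<_)
open import Data.Nat.Properties
  using (*-assoc; *-identityˡ; *-cancelˡ-≡; suc-injective; even≢odd)
open import Data.Product.Base using (∃-syntax; Σ-syntax; _×_; _,_)
open import Data.Sum.Base using (_⊎_)
open import Data.Vec.Base as Vec using (Vec; []; _∷_; lookup)
open import Function.Bundles using (_↣_; mk↣; _⇔_; Injection)
open import Level using (Level; Lift; 0ℓ; _⊔_) renaming (suc to lsuc)
open import Relation.Binary.PropositionalEquality
  using (_≡_; refl; sym; trans; cong; cong₂)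
open import Relation.Unary using (Pred; _∪_; _≐_)

private
  variable
    ℓ : Level
    k m n s : ℕ

-- The μ-recursive functions serve as the model of computation.
data Rec : ℕ → Set where
  zer  : Rec n
  succ : Rec 1
  proj : Fin n → Rec n
  comp : Rec m → Vec (Rec n) m → Rec n
  prec : Rec n → Rec (2 + n) → Rec (1 + n)
  μ    : Rec (1 + n) → Rec n

infix 4 _⟦_⟧⇓_

-- f ⟦ xs ⟧⇓ y : the partial function denoted by f is defined at xs, with
-- value y.
data _⟦_⟧⇓_ : Rec n → Vec ℕ n → ℕ → Set where
  zer   : {xs : Vec ℕ n} → zer ⟦ xs ⟧⇓ 0
  succ  : ∀ {x} → succ ⟦ x ∷ [] ⟧⇓ suc x
  proj  : ∀ {xs : Vec ℕ n} i → proj i ⟦ xs ⟧⇓ lookup xs i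
  comp  : ∀ {f : Rec m} {gs : Vec (Rec n) m} {xs ys z} →
          (∀ j → lookup gs j ⟦ xs ⟧⇓ lookup ys j) →
          f ⟦ ys ⟧⇓ z →
          comp f gs ⟦ xs ⟧⇓ z
  prec₀ : ∀ {f : Rec n} {g xs y} →
          f ⟦ xs ⟧⇓ y →
          prec f g ⟦ 0 ∷ xs ⟧⇓ y
  precₛ : ∀ {f : Rec n} {g xs x y z} →
          prec f g ⟦ x ∷ xs ⟧⇓ y →
          g ⟦ x ∷ y ∷ xs ⟧⇓ z →
          prec f g ⟦ suc x ∷ xs ⟧⇓ z
  μ     : ∀ {f : Rec (1 + n)} {xs x} →
          (∀ {w} → w < x → ∃[ y ] f ⟦ w ∷ xs ⟧⇓ suc y) →
          f ⟦ x ∷ xs ⟧⇓ 0 →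
          μ f ⟦ xs ⟧⇓ x

Computable : (ℕ → ℕ) → Set
Computable f = ∃[ c ] (∀ x → c ⟦ x ∷ [] ⟧⇓ f x)

ComputableRelation : (ℕ → ℕ → Bool) → Set
ComputableRelation χ =
  ∃[ c ] (∀ x y → c ⟦ x ∷ y ∷ [] ⟧⇓ (if χ x y then 1 else 0))

Σ⁰₁ : Pred ℕ 0ℓ → Set
Σ⁰₁ A = ∃[ χ ] ComputableRelation χ × (∀ x → A x ⇔ (∃[ y ] T (χ x y)))

-- Computable many-one reducibility of a set of numbers to a decision
-- problem P whose instances are presented by Gödel numbers.
ManyOneReducible : {I : Set} → I ↣ ℕ → Pred ℕ 0ℓ → Pred I ℓ → Set ℓ
ManyOneReducible {I = I} gödel A P =
  Σ[ f ∈ (ℕ → I) ] Computable (λ x → Injection.to gödel (f x)) ×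
         (∀ x → A x ⇔ P (f x))

Σ⁰₁-Hard : {I : Set} → I ↣ ℕ → Pred I ℓ → Set (lsuc 0ℓ ⊔ ℓ)
Σ⁰₁-Hard gödel P = (A : Pred ℕ 0ℓ) → Σ⁰₁ A → ManyOneReducible gödel A P

-- Atomic propositions are Fin k throughout, so that 2^AP is Subset k.
data LTL (k : ℕ) : Set where
  atom  : Fin k → LTL k
  natom : Fin k → LTL k
  _∨_   : LTL k → LTL k → LTL k
  _∧_   : LTL k → LTL k → LTL k
  X     : LTL k → LTL k
  _U_   : LTL k → LTL k → LTL k
  _W_   : LTL k → LTL k → LTL k

Trace : ℕ → Set
Trace k = ℕ → Subset k

infix 4 _∣_⊩_ _∣_⊨_

_∣_⊩_ : Trace k → ℕ → LTL k → Set
t ∣ i ⊩ atom p  = p ∈ t i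
t ∣ i ⊩ natom p = p ∉ t i
t ∣ i ⊩ (φ ∨ ψ) = t ∣ i ⊩ φ ⊎ t ∣ i ⊩ ψ
t ∣ i ⊩ (φ ∧ ψ) = t ∣ i ⊩ φ × t ∣ i ⊩ ψ
t ∣ i ⊩ X φ     = t ∣ suc i ⊩ φ
t ∣ i ⊩ (φ U ψ) =
  ∃[ l ] i ≤ l × t ∣ l ⊩ ψ × (∀ j → i ≤ j → j < l → t ∣ j ⊩ φ)
t ∣ i ⊩ (φ W ψ) =
  ∀ l → i ≤ l → t ∣ l ⊩ φ ⊎ (∃[ j ] i ≤ j × j ≤ l × t ∣ j ⊩ ψ)

data TeamLTL (k : ℕ) : Set where
  atom  : Fin k → TeamLTL k
  natom : Fin k → TeamLTL k
  _∨_   : TeamLTL k → TeamLTL k → TeamLTL k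
  _∧_   : TeamLTL k → TeamLTL k → TeamLTL k
  X     : TeamLTL k → TeamLTL k
  _U_   : TeamLTL k → TeamLTL k → TeamLTL k
  _W_   : TeamLTL k → TeamLTL k → TeamLTL k
  _⊆_   : Vec (LTL k) (suc n) → Vec (LTL k) (suc n) → TeamLTL k
  _∨ᴮ_  : TeamLTL k → TeamLTL k → TeamLTL k

TraceSet : ℕ → Set₁
TraceSet k = Pred (Trace k) 0ℓ

-- Splitting quantifies over sets of traces, so satisfaction lives in Set₁.
-- Equality of two LTL truth values is rendered as logical equivalence.
_∣_⊨_ : TraceSet k → ℕ → TeamLTL k → Set₁
S ∣ i ⊨ atom p   = Lift _ (∀ t → S t → p ∈ t i)
S ∣ i ⊨ natom p  = Lift _ (∀ t → S t → p ∉ t i)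
S ∣ i ⊨ (φ ∨ ψ)  =
  ∃[ S₁ ] ∃[ S₂ ] (S₁ ∪ S₂) ≐ S × S₁ ∣ i ⊨ φ × S₂ ∣ i ⊨ ψ
S ∣ i ⊨ (φ ∧ ψ)  = S ∣ i ⊨ φ × S ∣ i ⊨ ψ
S ∣ i ⊨ X φ      = S ∣ suc i ⊨ φ
S ∣ i ⊨ (φ U ψ)  =
  ∃[ l ] i ≤ l × S ∣ l ⊨ ψ × (∀ j → i ≤ j → j < l → S ∣ j ⊨ φ)
S ∣ i ⊨ (φ W ψ)  =
  ∀ l → i ≤ l → S ∣ l ⊨ φ ⊎ (∃[ j ] i ≤ j × j ≤ l × S ∣ j ⊨ ψ)
S ∣ i ⊨ (φs ⊆ ψs) = Lift _
  (∀ t → S t → ∃[ t′ ] S t′ ×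
    (∀ j → (t ∣ i ⊩ lookup φs j) ⇔ (t′ ∣ i ⊩ lookup ψs j)))
S ∣ i ⊨ (φ ∨ᴮ ψ) = S ∣ i ⊨ φ ⊎ S ∣ i ⊨ ψ

-- The set of states is Fin s.
record Kripke (k s : ℕ) : Set where
  constructor kripke
  field
    successors : Vec (Subset s) s     -- (v , w) ∈ R iff w ∈ lookup successors v
    label      : Vec (Subset k) s
    initial    : Fin s

  IsPath : (ℕ → Fin s) → Set
  IsPath σ = σ 0 ≡ initial × (∀ i → σ (suc i) ∈ lookup successors (σ i))

open Kripke

-- A trace is compared with the labels of a path position by position, as
-- functions on ℕ are not extensional.
Traces : Kripke k s → TraceSet k
Traces K t = ∃[ σ ] IsPath K σ × (∀ i → t i ≡ lookup (label K) (σ i))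

record Instance : Set where
  constructor inst
  field
    propositions : ℕ
    states       : ℕ
    formula      : TeamLTL propositions
    structure    : Kripke propositions states

ModelChecking : Pred Instance (lsuc 0ℓ)
ModelChecking I = Traces structure ∣ 0 ⊨ formula
  where open Instance I

-- Opaque only so that the type checker does not compute large unary numbers.
opaque
  ⟨_,_⟩ : ℕ → ℕ → ℕ
  ⟨ a , b ⟩ = 2 ^ a * suc (2 * b)

  ⟨,⟩-def : ∀ a b → ⟨ a , b ⟩ ≡ 2 ^ a * suc (2 * b)
  ⟨,⟩-def a b = refl

⌜_⌝ᵛ : Vec ℕ n → ℕ
⌜ [] ⌝ᵛ     = 0
⌜ x ∷ xs ⌝ᵛ = ⟨ x , ⌜ xs ⌝ᵛ ⟩

⌜_⌝ˢ : Subset n → ℕ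
⌜ p ⌝ˢ = ⌜ Vec.map (λ b → if b then 1 else 0) p ⌝ᵛ

tagᴸ bodyᴸ ⌜_⌝ᴸ : LTL k → ℕ

tagᴸ (atom _)  = 0
tagᴸ (natom _) = 1
tagᴸ (_ ∨ _)   = 2
tagᴸ (_ ∧ _)   = 3
tagᴸ (X _)     = 4
tagᴸ (_ U _)   = 5
tagᴸ (_ W _)   = 6

bodyᴸ (atom p)  = toℕ p
bodyᴸ (natom p) = toℕ p
bodyᴸ (φ ∨ ψ)   = ⟨ ⌜ φ ⌝ᴸ , ⌜ ψ ⌝ᴸ ⟩
bodyᴸ (φ ∧ ψ)   = ⟨ ⌜ φ ⌝ᴸ , ⌜ ψ ⌝ᴸ ⟩
bodyᴸ (X φ)     = ⌜ φ ⌝ᴸ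
bodyᴸ (φ U ψ)   = ⟨ ⌜ φ ⌝ᴸ , ⌜ ψ ⌝ᴸ ⟩
bodyᴸ (φ W ψ)   = ⟨ ⌜ φ ⌝ᴸ , ⌜ ψ ⌝ᴸ ⟩

⌜ φ ⌝ᴸ = ⟨ tagᴸ φ , bodyᴸ φ ⟩

tag body ⌜_⌝ : TeamLTL k → ℕ

tag (atom _)  = 0
tag (natom _) = 1
tag (_ ∨ _)   = 2
tag (_ ∧ _)   = 3
tag (X _)     = 4
tag (_ U _)   = 5
tag (_ W _)   = 6
tag (_ ⊆ _)   = 7
tag (_ ∨ᴮ _)  = 8

body (atom p)  = toℕ p
body (natom p) = toℕ p
body (φ ∨ ψ)   = ⟨ ⌜ φ ⌝ , ⌜ ψ ⌝ ⟩
body (φ ∧ ψ)   = ⟨ ⌜ φ ⌝ , ⌜ ψ ⌝ ⟩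
body (X φ)     = ⌜ φ ⌝
body (φ U ψ)   = ⟨ ⌜ φ ⌝ , ⌜ ψ ⌝ ⟩
body (φ W ψ)   = ⟨ ⌜ φ ⌝ , ⌜ ψ ⌝ ⟩
body (_⊆_ {n = n} φs ψs) =
  ⟨ n , ⟨ ⌜ Vec.map ⌜_⌝ᴸ φs ⌝ᵛ , ⌜ Vec.map ⌜_⌝ᴸ ψs ⌝ᵛ ⟩ ⟩
body (φ ∨ᴮ ψ)  = ⟨ ⌜ φ ⌝ , ⌜ ψ ⌝ ⟩

⌜ φ ⌝ = ⟨ tag φ , body φ ⟩

⌜_⌝ᴷ : Kripke k s → ℕ
⌜ kripke R η w₀ ⌝ᴷ =
  ⟨ ⌜ Vec.map ⌜_⌝ˢ R ⌝ᵛ , ⟨ ⌜ Vec.map ⌜_⌝ˢ η ⌝ᵛ , toℕ w₀ ⟩ ⟩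

⌜_⌝ᴵ : Instance → ℕ
⌜ inst k s φ K ⌝ᴵ = ⟨ k , ⟨ s , ⟨ ⌜ φ ⌝ , ⌜ K ⌝ᴷ ⟩ ⟩ ⟩

opaque
  unfolding ⟨_,_⟩

  ⟨,⟩-injective : ∀ a b {c d} → ⟨ a , c ⟩ ≡ ⟨ b , d ⟩ → a ≡ b × c ≡ d
  ⟨,⟩-injective zero zero {c} {d} eq =
    refl , *-cancelˡ-≡ c d 2 (suc-injective
      (trans (sym (*-identityˡ _)) (trans eq (*-identityˡ _))))
  ⟨,⟩-injective zero (suc b) {c} {d} eq
    with () ← even≢odd ⟨ b , d ⟩ c
      (trans (sym (*-assoc 2 (2 ^ b) _)) (trans (sym eq) (*-identityˡ _)))
  ⟨,⟩-injective (suc a) zero {c} {d} eq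
    with () ← even≢odd ⟨ a , c ⟩ d
      (trans (sym (*-assoc 2 (2 ^ a) _)) (trans eq (*-identityˡ _)))
  ⟨,⟩-injective (suc a) (suc b) {c} {d} eq =
    let p , q = ⟨,⟩-injective a b (*-cancelˡ-≡ ⟨ a , c ⟩ ⟨ b , d ⟩ 2
          (trans (sym (*-assoc 2 (2 ^ a) _)) (trans eq (*-assoc 2 (2 ^ b) _))))
    in cong suc p , q

⌜map⌝ᵛ-injective : ∀ {A : Set} {f : A → ℕ} → (∀ x y → f x ≡ f y → x ≡ y) →
  (xs ys : Vec A n) → ⌜ Vec.map f xs ⌝ᵛ ≡ ⌜ Vec.map f ys ⌝ᵛ → xs ≡ ys
⌜map⌝ᵛ-injective f-inj []       []       _  = refl
⌜map⌝ᵛ-injective f-inj (x ∷ xs) (y ∷ ys) eq =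
  let p , q = ⟨,⟩-injective _ _ eq
  in cong₂ _∷_ (f-inj x y p) (⌜map⌝ᵛ-injective f-inj xs ys q)

⌜⌝ˢ-injective : (p q : Subset n) → ⌜ p ⌝ˢ ≡ ⌜ q ⌝ˢ → p ≡ q
⌜⌝ˢ-injective = ⌜map⌝ᵛ-injective λ where
  true  true  _ → refl
  false false _ → refl

⌜⌝ᴸ-injective : (φ ψ : LTL k) → ⌜ φ ⌝ᴸ ≡ ⌜ ψ ⌝ᴸ → φ ≡ ψ
bodyᴸ-injective : (φ ψ : LTL k) → tagᴸ φ ≡ tagᴸ ψ → bodyᴸ φ ≡ bodyᴸ ψ → φ ≡ ψ

⌜⌝ᴸ-injective φ ψ eq =
  let p , q = ⟨,⟩-injective _ _ eq in bodyᴸ-injective φ ψ p q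

bodyᴸ-injective (atom p)  (atom q)    refl eq = cong atom (toℕ-injective eq)
bodyᴸ-injective (natom p) (natom q)   refl eq = cong natom (toℕ-injective eq)
bodyᴸ-injective (φ ∨ ψ)   (φ′ ∨ ψ′)   refl eq =
  let p , q = ⟨,⟩-injective _ _ eq
  in cong₂ _∨_ (⌜⌝ᴸ-injective φ φ′ p) (⌜⌝ᴸ-injective ψ ψ′ q)
bodyᴸ-injective (φ ∧ ψ)   (φ′ ∧ ψ′)   refl eq =
  let p , q = ⟨,⟩-injective _ _ eq
  in cong₂ _∧_ (⌜⌝ᴸ-injective φ φ′ p) (⌜⌝ᴸ-injective ψ ψ′ q)
bodyᴸ-injective (X φ)     (X ψ)       refl eq = cong X (⌜⌝ᴸ-injective φ ψ eq)
bodyᴸ-injective (φ U ψ)   (φ′ U ψ′)   refl eq =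
  let p , q = ⟨,⟩-injective _ _ eq
  in cong₂ _U_ (⌜⌝ᴸ-injective φ φ′ p) (⌜⌝ᴸ-injective ψ ψ′ q)
bodyᴸ-injective (φ W ψ)   (φ′ W ψ′)   refl eq =
  let p , q = ⟨,⟩-injective _ _ eq
  in cong₂ _W_ (⌜⌝ᴸ-injective φ φ′ p) (⌜⌝ᴸ-injective ψ ψ′ q)

⌜⌝-injective : (φ ψ : TeamLTL k) → ⌜ φ ⌝ ≡ ⌜ ψ ⌝ → φ ≡ ψ
body-injective : (φ ψ : TeamLTL k) → tag φ ≡ tag ψ → body φ ≡ body ψ → φ ≡ ψ

⌜⌝-injective φ ψ eq =
  let p , q = ⟨,⟩-injective _ _ eq in body-injective φ ψ p q

body-injective (atom p)  (atom q)    refl eq = cong atom (toℕ-injective eq)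
body-injective (natom p) (natom q)   refl eq = cong natom (toℕ-injective eq)
body-injective (φ ∨ ψ)   (φ′ ∨ ψ′)   refl eq =
  let p , q = ⟨,⟩-injective _ _ eq
  in cong₂ _∨_ (⌜⌝-injective φ φ′ p) (⌜⌝-injective ψ ψ′ q)
body-injective (φ ∧ ψ)   (φ′ ∧ ψ′)   refl eq =
  let p , q = ⟨,⟩-injective _ _ eq
  in cong₂ _∧_ (⌜⌝-injective φ φ′ p) (⌜⌝-injective ψ ψ′ q)
body-injective (X φ)     (X ψ)       refl eq = cong X (⌜⌝-injective φ ψ eq)
body-injective (φ U ψ)   (φ′ U ψ′)   refl eq =
  let p , q = ⟨,⟩-injective _ _ eq
  in cong₂ _U_ (⌜⌝-injective φ φ′ p) (⌜⌝-injective ψ ψ′ q)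
body-injective (φ W ψ)   (φ′ W ψ′)   refl eq =
  let p , q = ⟨,⟩-injective _ _ eq
  in cong₂ _W_ (⌜⌝-injective φ φ′ p) (⌜⌝-injective ψ ψ′ q)
body-injective (_⊆_ {n = n} φs ψs) (_⊆_ {n = n′} φs′ ψs′) refl eq
  with refl , eq′ ← ⟨,⟩-injective n n′ eq =
  let p , q = ⟨,⟩-injective _ _ eq′
  in cong₂ _⊆_ (⌜map⌝ᵛ-injective ⌜⌝ᴸ-injective φs φs′ p)
               (⌜map⌝ᵛ-injective ⌜⌝ᴸ-injective ψs ψs′ q)
body-injective (φ ∨ᴮ ψ)  (φ′ ∨ᴮ ψ′)  refl eq =
  let p , q = ⟨,⟩-injective _ _ eq
  in cong₂ _∨ᴮ_ (⌜⌝-injective φ φ′ p) (⌜⌝-injective ψ ψ′ q)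

⌜⌝ᴷ-injective : (K L : Kripke k s) → ⌜ K ⌝ᴷ ≡ ⌜ L ⌝ᴷ → K ≡ L
⌜⌝ᴷ-injective (kripke R η w) (kripke R′ η′ w′) eq
  with p , eq′ ← ⟨,⟩-injective _ _ eq
  with q , r   ← ⟨,⟩-injective _ _ eq′
  with refl ← ⌜map⌝ᵛ-injective ⌜⌝ˢ-injective R R′ p
     | refl ← ⌜map⌝ᵛ-injective ⌜⌝ˢ-injective η η′ q
     | refl ← toℕ-injective {i = w} {j = w′} r = refl

⌜⌝ᴵ-injective : ∀ {I J} → ⌜ I ⌝ᴵ ≡ ⌜ J ⌝ᴵ → I ≡ J
⌜⌝ᴵ-injective {inst k s φ K} {inst k′ s′ φ′ K′} eq
  with refl , eq₁ ← ⟨,⟩-injective k k′ eq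
  with refl , eq₂ ← ⟨,⟩-injective s s′ eq₁
  with p , q ← ⟨,⟩-injective _ _ eq₂
  with refl ← ⌜⌝-injective φ φ′ p | refl ← ⌜⌝ᴷ-injective K K′ q = refl

instanceNumbering : Instance ↣ ℕ
instanceNumbering = mk↣ ⌜⌝ᴵ-injective

{-# OPTIONS --safe #-}

-- A Σ⁰₁ set is the domain of a nondeterministic register program that guesses
-- the witness y and runs the decider, so it suffices to express halting of such
-- a program.  A team encodes a run by one trace per configuration, the j-th one
-- being activated at time 2 + j and storing every register as the distance from
-- its activation to the next mark of that register.  Because the semantics is
-- synchronous, copying a register to the next configuration shifts its mark by
-- one and incrementing shifts it by two.  At time 2 + j the formula splits off
-- the traces of configurations j and j + 1 and relates their marks at all later
-- times by Boolean disjunctions inside W; an inclusion atom forces the next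
-- configuration to exist.  A U formula repeats this until the halting location
-- is reached.
module Submission where

open import Defs

open import Data.Bool.Base using (Bool; true; false; not; if_then_else_; T)
open import Data.Bool.Properties using (not-¬; ¬-not; T-≡)
open import Data.Fin.Base using (Fin; zero; suc; toℕ; finToFun; funToFin)
open import Data.Fin.Properties using (2↔Bool; finToFun-funToFin)
open import Data.Fin.Subset using (Subset; ⁅_⁆; _∈_)
  renaming (⊥ to ∅; ⊤ to full)
open import Data.Fin.Subset.Properties using (x∈⁅x⁆; x∈⁅y⁆⇒x≡y; ∈⊤)
open import Data.List.Base using (List; []; _∷_; _++_; foldr; upTo)
open import Data.List.Membership.Propositional using () renaming (_∈_ to _∈ₗ_)
open import Data.List.Membership.Propositional.Properties
  using (∈-++⁺ˡ; ∈-++⁺ʳ; ∈-++⁻; ∈-upTo⁺; ∈-upTo⁻)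
open import Data.List.Relation.Unary.Any using (here; there)
open import Data.Nat.Base
  using (ℕ; zero; suc; _+_; _*_; _^_; _∸_; _≤_; _<_; z≤n; s≤s; _≡ᵇ_; _⊔_;
         _≤′_; ≤′-refl; ≤′-step)
open import Data.Nat.Properties
open import Data.Product.Base using (∃-syntax; _×_; _,_; proj₁; proj₂)
open import Data.Sum.Base using (_⊎_; inj₁; inj₂; [_,_]′)
open import Data.Unit.Base using (⊤; tt)
open import Data.Vec.Base as Vec
  using (Vec; []; _∷_; lookup; tabulate; replicate; here)
open import Data.Vec.Properties
  using ([]=⇒lookup; lookup⇒[]=; lookup-map; lookup-replicate; lookup∘tabulate;
         tabulate∘lookup; tabulate-cong)
open import Data.Vec.Relation.Unary.All as All using (All; []; _∷_)
open import Function.Base using (_∘_)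
open import Function.Bundles using (_⇔_; mk⇔; Equivalence; Inverse)
open import Level using (lift; lower)
open import Relation.Binary.Construct.Closure.ReflexiveTransitive
  using (Star; _◅_; _◅◅_) renaming (ε to nil)
open import Relation.Binary.Definitions using (tri<; tri≈; tri>)
open import Relation.Binary.PropositionalEquality
open import Relation.Nullary.Decidable using (does; yes; no; dec-true; dec-false)
open import Relation.Nullary.Negation using (¬_; contradiction)

-- That a bit of the old configuration equals a bit of the new one is a property of two traces at
-- once. A splitting disjunction would let each trace choose its own bit; `∨ᴮ` imposes one bit on
-- both. The comparison goes on after the step, when `act` no longer tells the two traces apart.
-- Hence each trace carries the constant bit `dir`, opposite on consecutive configurations.
--
-- The Kripke structure generates every sequence of letters after a fixed first one, so the run is
-- guessed by the first split. An empty guess would satisfy everything. One additional trace, the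
-- trap, prevents this: it alone carries `ini` at time one, which forces it into the guessed part,
-- where an inclusion atom demands an initial configuration on its behalf. As inclusion atoms
-- compare truth values, inactive traces need a witness too, and the trap, never active, is that
-- witness.

private variable
  k m n : ℕ

-- Register programs for recursive functions

-- A run of the compiled decider and the hypothesis on `χ` give two evaluations of one function;
-- their values have to be identified.
⇓-functional : (f : Rec n) {xs : Vec ℕ n} {y z : ℕ} →
  f ⟦ xs ⟧⇓ y → f ⟦ xs ⟧⇓ z → y ≡ z
⇓-functionals : (gs : Vec (Rec n) m) {xs : Vec ℕ n} {ys zs : Vec ℕ m} →
  (∀ j → lookup gs j ⟦ xs ⟧⇓ lookup ys j) →
  (∀ j → lookup gs j ⟦ xs ⟧⇓ lookup zs j) → ys ≡ zs

⇓-functional zer         zer           zer           = refl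
⇓-functional succ        succ          succ          = refl
⇓-functional (proj i)    (proj .i)     (proj .i)     = refl
⇓-functional (comp f gs) (comp {ys = ys} ds d) (comp {ys = zs} es e)
  with refl ← ⇓-functionals gs {ys = ys} {zs} ds es = ⇓-functional f d e
⇓-functional (prec f g)  (prec₀ d)     (prec₀ e)     = ⇓-functional f d e
⇓-functional (prec f g)  (precₛ d d′)  (precₛ e e′)
  with refl ← ⇓-functional (prec f g) d e = ⇓-functional g d′ e′
⇓-functional (μ f) {y = x} {z = y} (μ below d) (μ below′ e) with <-cmp x y
... | tri≈ _ x≡y _ = x≡y
... | tri< x<y _ _ with () ← ⇓-functional f d (proj₂ (below′ x<y))
... | tri> _ _ y<x with () ← ⇓-functional f e (proj₂ (below y<x))

⇓-functionals []       {ys = []}     {[]}     _  _  = refl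
⇓-functionals (g ∷ gs) {ys = _ ∷ _} {_ ∷ _} ds es =
  cong₂ _∷_ (⇓-functional g (ds zero) (es zero))
            (⇓-functionals gs (λ j → ds (suc j)) (λ j → es (suc j)))

State : Set
State = ℕ → ℕ

data Source : Set where
  null      : Source
  copy incr : ℕ → Source

value : Source → State → ℕ
value null     s = 0
value (copy r) s = s r
value (incr r) s = suc (s r)

-- There is no branching and no decrement. A failed guard blocks the run and loops end
-- nondeterministically, so counting up and comparing replaces counting down.
data Op : Set where
  _≔_  : ℕ → Source → Op
  test : ℕ → Bool → Op
  _==_ : ℕ → ℕ → Op

infix 6 _≔_ _==_

-- Assigning a source to every register, untouched ones included, lets the formula treat a step
-- register by register with one clause per kind of source.
source : Op → ℕ → Source
source (r′ ≔ e)   r = if does (r ≟ r′) then e else copy r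
source (test _ _) r = copy r
source (_ == _)   r = copy r

exec : Op → State → State
exec o s r = value (source o r) s

Guard : Op → State → Set
Guard (_ ≔ _)    s = ⊤
Guard (test r b) s = (s r ≡ᵇ 0) ≡ b
Guard (r == r′)  s = s r ≡ s r′

infixr 5 _⨾_

data Program : Set where
  op   : Op → Program
  _⨾_  : Program → Program → Program
  loop : Program → Program

-- Comparing a register with itself always succeeds, and `exec skip s` is `s` by eta, so skips leave
-- the states of a run definitionally unchanged.
skip : Op
skip = 0 == 0

⟦_⟧ : Program → State → State → Set
⟦ op o ⟧   s s′ = Guard o s × s′ ≡ exec o s
⟦ P ⨾ Q ⟧  s s′ = ∃[ u ] ⟦ P ⟧ s u × ⟦ Q ⟧ u s′
⟦ loop P ⟧      = Star ⟦ P ⟧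

exec-≔ : ∀ r e s → exec (r ≔ e) s r ≡ value e s
exec-≔ r e s rewrite dec-true (r ≟ r) refl = refl

exec-≔-other : ∀ {r r′} e s → r ≢ r′ → exec (r′ ≔ e) s r ≡ s r
exec-≔-other {r} {r′} e s r≢r′ rewrite dec-false (r ≟ r′) r≢r′ = refl

loop-invariant : ∀ P (I : State → Set) → (∀ {s s′} → ⟦ P ⟧ s s′ → I s → I s′) →
  ∀ {s s′} → ⟦ loop P ⟧ s s′ → I s → I s′
loop-invariant P I step nil        i = i
loop-invariant P I step (x ◅ xs) i = loop-invariant P I step xs (step x i)

_Avoids_ : Program → ℕ → Set
op (r′ ≔ _)   Avoids r = r ≢ r′
op (test _ _) Avoids r = ⊤
op (_ == _)   Avoids r = ⊤
(P ⨾ Q)       Avoids r = P Avoids r × Q Avoids r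
loop P        Avoids r = P Avoids r

avoided : ∀ P {r s s′} → P Avoids r → ⟦ P ⟧ s s′ → s′ r ≡ s r
avoided (op (r′ ≔ e))   a (_ , refl) = exec-≔-other e _ a
avoided (op (test _ _)) a (_ , refl) = refl
avoided (op (_ == _))   a (_ , refl) = refl
avoided (P ⨾ Q) (a , b) (_ , p , q)  = trans (avoided Q b q) (avoided P a p)
avoided (loop P) {r} {s} a ps        =
  loop-invariant P (λ u → u r ≡ s r) (λ p eq → trans (avoided P a p) eq) ps refl

-- Compilation of μ-recursive functions

block : ℕ → ∀ m → Vec ℕ m
block r zero    = []
block r (suc m) = r ∷ block (suc r) m

-- compile f ins out b reads the arguments from ins, writes the value to out,
-- and otherwise writes only to registers ≥ b.
compile    : Rec n → Vec ℕ n → ℕ → ℕ → Program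
compileAll : Vec (Rec n) m → Vec ℕ n → ℕ → ℕ → Program
precBody   : Rec (2 + n) → Vec ℕ n → ℕ → Program
μBody      : Rec (1 + n) → Vec ℕ n → ℕ → Program

compile zer         ins        out b = op (out ≔ null)
compile succ        (r ∷ [])   out b = op (out ≔ incr r)
compile (proj i)    ins        out b = op (out ≔ copy (lookup ins i))
compile (comp {m = m} f gs) ins out b =
  compileAll gs ins b (m + b) ⨾ compile f (block b m) out (m + b)
compile (prec f g)  (r ∷ ins)  out b =
  -- The loop may end after any number of rounds; the comparison `b == r` discards every run that
  -- stopped at the wrong count.
  compile f ins (1 + b) (2 + b) ⨾ op (b ≔ null) ⨾ loop (precBody g ins b) ⨾
  op (b == r) ⨾ op (out ≔ copy (1 + b))
compile (μ f)       ins        out b =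
  -- A round passes only at a nonzero value and the final evaluation only at zero, so a surviving
  -- run has counted exactly to the least zero.
  op (b ≔ null) ⨾ loop (μBody f ins b) ⨾
  compile f (b ∷ ins) (1 + b) (2 + b) ⨾ op (test (1 + b) true) ⨾
  op (out ≔ copy b)

compileAll []       ins out b = op skip
compileAll (g ∷ gs) ins out b = compile g ins out b ⨾ compileAll gs ins (suc out) b

precBody g ins b =
  -- The accumulator `1 + b` is both argument and target. This is safe because compiled code writes
  -- its target only in its last operation.
  compile g (b ∷ (1 + b) ∷ ins) (1 + b) (2 + b) ⨾ op (b ≔ incr b)

μBody f ins b =
  compile f (b ∷ ins) (1 + b) (2 + b) ⨾ op (test (1 + b) false) ⨾
  op (b ≔ incr b)

compile-avoids    : (f : Rec n) (ins : Vec ℕ n) (out b : ℕ) {r : ℕ} →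
  r < b → r ≢ out → compile f ins out b Avoids r
compileAll-avoids : (gs : Vec (Rec n) m) (ins : Vec ℕ n) (out b : ℕ) {r : ℕ} →
  r < b → r < out → compileAll gs ins out b Avoids r

private
  weaken : ∀ {r b} k → r < b → r < k + b
  weaken k r<b = <-≤-trans r<b (m≤n+m _ k)

compile-avoids zer        ins       out b r<b r≢out = r≢out
compile-avoids succ       (_ ∷ [])  out b r<b r≢out = r≢out
compile-avoids (proj _)   ins       out b r<b r≢out = r≢out
compile-avoids (comp {m = m} f gs) ins out b r<b r≢out =
  compileAll-avoids gs ins b (m + b) (weaken m r<b) r<b ,
  compile-avoids f _ out (m + b) (weaken m r<b) r≢out
compile-avoids (prec f g) (_ ∷ ins) out b r<b r≢out =
  compile-avoids f ins (1 + b) (2 + b) (weaken 2 r<b) (<⇒≢ (weaken 1 r<b)) ,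
  <⇒≢ r<b ,
  (compile-avoids g _ (1 + b) (2 + b) (weaken 2 r<b) (<⇒≢ (weaken 1 r<b)) ,
   <⇒≢ r<b) ,
  tt , r≢out
compile-avoids (μ f)      ins       out b r<b r≢out =
  <⇒≢ r<b , (avoids-f , tt , <⇒≢ r<b) , avoids-f , tt , r≢out
  where
  avoids-f : compile f (b ∷ ins) (1 + b) (2 + b) Avoids _
  avoids-f = compile-avoids f _ (1 + b) (2 + b) (weaken 2 r<b) (<⇒≢ (weaken 1 r<b))

compileAll-avoids []       ins out b r<b r<out = tt
compileAll-avoids (g ∷ gs) ins out b r<b r<out =
  compile-avoids g ins out b r<b (<⇒≢ r<out) ,
  compileAll-avoids gs ins (suc out) b r<b (m<n⇒m<1+n r<out)

infix 4 _≈[_]_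

_≈[_]_ : State → ℕ → State → Set
s ≈[ b ] s′ = ∀ {r} → r < b → s r ≡ s′ r

≈-trans : ∀ {s t u b} → s ≈[ b ] t → t ≈[ b ] u → s ≈[ b ] u
≈-trans p q r<b = trans (p r<b) (q r<b)

map-≈ : ∀ {s s′ b} {ins : Vec ℕ n} → All (_< b) ins → s ≈[ b ] s′ →
  Vec.map s ins ≡ Vec.map s′ ins
map-≈ []       eq = refl
map-≈ (p ∷ ps) eq = cong₂ _∷_ (eq p) (map-≈ ps eq)

avoided-≈ : ∀ P {b s s′} → (∀ {r} → r < b → P Avoids r) → ⟦ P ⟧ s s′ → s′ ≈[ b ] s
avoided-≈ P avoids p r<b = avoided P (avoids r<b) p

-- In `prec` and `μ`, register `b` is the counter, `1 + b` the result, and scratch space starts at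
-- `2 + b`; an inner call thus preserves the arguments and the counter.
scratch-≈ : ∀ (f : Rec n) ins b {s s′} →
  ⟦ compile f ins (1 + b) (2 + b) ⟧ s s′ → s′ ≈[ 1 + b ] s
scratch-≈ f ins b = avoided-≈ (compile f ins (1 + b) (2 + b))
  (λ r<b → compile-avoids f ins (1 + b) (2 + b) (m<n⇒m<1+n r<b) (<⇒≢ r<b))

set-≈ : ∀ b e s → exec (b ≔ e) s ≈[ b ] s
set-≈ b e s r<b = exec-≔-other e s (<⇒≢ r<b)

block-< : ∀ r m → All (_< m + r) (block r m)
block-< r zero    = []
block-< r (suc m) =
  s≤s (m≤n+m r m) ∷ subst (λ k → All (_< k) (block (suc r) m)) (+-suc m r) (block-< (suc r) m)

weakenAll : ∀ {b} {ins : Vec ℕ n} k → All (_< b) ins → All (_< k + b) ins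
weakenAll k = All.map (weaken k)

-- Correctness of the compilation

compile-sound : (f : Rec n) (ins : Vec ℕ n) (out b : ℕ) {s s′ : State} →
  All (_< b) ins → out < b →
  ⟦ compile f ins out b ⟧ s s′ → f ⟦ Vec.map s ins ⟧⇓ s′ out
compileAll-sound : (gs : Vec (Rec n) m) (ins : Vec ℕ n) (out b : ℕ) {s s′ : State} →
  All (_< out) ins → m + out ≤ b →
  ⟦ compileAll gs ins out b ⟧ s s′ →
  ∀ j → lookup gs j ⟦ Vec.map s ins ⟧⇓ lookup (Vec.map s′ (block out m)) j

compile-sound zer      ins      out b {s} _ _ (_ , refl)
  rewrite exec-≔ out null s = zer
compile-sound succ     (r ∷ []) out b {s} _ _ (_ , refl)
  rewrite exec-≔ out (incr r) s = succ
compile-sound (proj i) ins      out b {s} _ _ (_ , refl)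
  rewrite exec-≔ out (copy (lookup ins i)) s | sym (lookup-map i s ins) = proj i
compile-sound (comp {m = m} f gs) ins out b ins<b out<b (u , p , q) =
  comp (compileAll-sound gs ins b (m + b) ins<b ≤-refl p)
       (compile-sound f (block b m) out (m + b) (block-< b m) (weaken m out<b) q)
compile-sound (prec f g) (r ∷ ins) out b {s} (r<b ∷ ins<b) out<b
  (u₁ , p , u₂ , (_ , refl) , u₃ , ps , _ , (u₃b≡u₃r , refl) , _ , refl)
  rewrite exec-≔ out (copy (1 + b)) u₃ =
  subst (λ x → prec f g ⟦ x ∷ Vec.map s ins ⟧⇓ u₃ (1 + b))
    (trans u₃b≡u₃r (proj₁ final r<b)) (proj₂ final)
  where
  Inv : State → Set
  Inv u = u ≈[ b ] s × prec f g ⟦ u b ∷ Vec.map s ins ⟧⇓ u (1 + b)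

  step : ∀ {u u′} → ⟦ precBody g ins b ⟧ u u′ → Inv u → Inv u′
  step {u} (v , q , _ , refl) (u≈s , d)
    rewrite exec-≔ b (incr b) v | exec-≔-other {1 + b} (incr b) v 1+n≢n
          | scratch-≈ g _ b q (n<1+n b) =
    ≈-trans (set-≈ b _ v) (≈-trans v≈u u≈s) ,
    precₛ d (subst (λ xs → g ⟦ u b ∷ u (1 + b) ∷ xs ⟧⇓ v (1 + b)) (map-≈ ins<b u≈s)
      (compile-sound g _ (1 + b) (2 + b)
        (m<n⇒m<1+n (n<1+n b) ∷ n<1+n (1 + b) ∷ weakenAll 2 ins<b) (n<1+n (1 + b)) q))
    where
    v≈u : v ≈[ b ] u
    v≈u r<b = scratch-≈ g _ b q (m<n⇒m<1+n r<b)

  start : Inv (exec (b ≔ null) u₁)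
  start rewrite exec-≔ b null u₁ | exec-≔-other {1 + b} null u₁ 1+n≢n =
    ≈-trans (set-≈ b _ u₁) (λ r<b → scratch-≈ f _ b p (m<n⇒m<1+n r<b)) ,
    prec₀ (compile-sound f ins (1 + b) (2 + b) (weakenAll 2 ins<b) (n<1+n (1 + b)) p)

  final : Inv u₃
  final = loop-invariant (precBody g ins b) Inv step ps start
compile-sound (μ f) ins out b {s} ins<b out<b
  (_ , (_ , refl) , u , ps , v , p , _ , (zero? , refl) , _ , refl)
  rewrite exec-≔ out (copy b) v | scratch-≈ f (b ∷ ins) b p (n<1+n b) =
  μ (proj₂ final) (subst₂ (λ xs y → f ⟦ u b ∷ xs ⟧⇓ y) (map-≈ ins<b (proj₁ final))
    (≡ᵇ⇒≡ (v (1 + b)) 0 (subst T (sym zero?) tt)) (sound p))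
  where
  sound : ∀ {u v} → ⟦ compile f (b ∷ ins) (1 + b) (2 + b) ⟧ u v →
    f ⟦ u b ∷ Vec.map u ins ⟧⇓ v (1 + b)
  sound = compile-sound f (b ∷ ins) (1 + b) (2 + b)
    (m<n⇒m<1+n (n<1+n b) ∷ weakenAll 2 ins<b) (n<1+n (1 + b))

  Inv : State → Set
  Inv u = u ≈[ b ] s × (∀ {w} → w < u b → ∃[ y ] f ⟦ w ∷ Vec.map s ins ⟧⇓ suc y)

  positive : ∀ {y} → (y ≡ᵇ 0) ≡ false → ∃[ z ] y ≡ suc z
  positive {suc y} _ = y , refl

  step : ∀ {u u′} → ⟦ μBody f ins b ⟧ u u′ → Inv u → Inv u′
  step {u} (v , q , _ , (nonzero , refl) , _ , refl) (u≈s , below)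
    rewrite exec-≔ b (incr b) v | scratch-≈ f (b ∷ ins) b q (n<1+n b) =
    ≈-trans (set-≈ b _ v) (≈-trans (λ r<b → scratch-≈ f _ b q (m<n⇒m<1+n r<b)) u≈s) ,
    below′
    where
    below′ : ∀ {w} → w < suc (u b) → ∃[ y ] f ⟦ w ∷ Vec.map s ins ⟧⇓ suc y
    below′ {w} (s≤s w≤) with m≤n⇒m<n∨m≡n w≤
    ... | inj₁ w<  = below w<
    ... | inj₂ refl =
      let z , eq = positive nonzero
      in z , subst₂ (λ xs y → f ⟦ u b ∷ xs ⟧⇓ y) (map-≈ ins<b u≈s) eq (sound q)

  start : Inv (exec (b ≔ null) s)
  start rewrite exec-≔ b null s = set-≈ b _ s , λ ()

  final : Inv u
  final = loop-invariant (μBody f ins b) Inv step ps start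

compileAll-sound (g ∷ gs) ins out b {s} {s′} ins<out m+out≤b (u , p , q) zero =
  subst (g ⟦ Vec.map s ins ⟧⇓_)
    (sym (avoided (compileAll gs ins (suc out) b)
      (compileAll-avoids gs ins (suc out) b out<b (n<1+n out)) q))
    (compile-sound g ins out b (All.map (λ r< → <-trans r< out<b) ins<out) out<b p)
  where
  out<b : out < b
  out<b = ≤-trans (s≤s (m≤n+m out _)) m+out≤b
compileAll-sound {m = suc m} (g ∷ gs) ins out b {s} ins<out m+out≤b (u , p , q) (suc j) =
  subst (λ xs → lookup gs j ⟦ xs ⟧⇓ _) (map-≈ ins<out u≈s)
    (compileAll-sound gs ins (suc out) b (All.map m<n⇒m<1+n ins<out)
      (≤-trans (≤-reflexive (+-suc m out)) m+out≤b) q j)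
  where
  u≈s : u ≈[ out ] s
  u≈s = avoided-≈ (compile g ins out b)
    (λ r< → compile-avoids g ins out b
      (<-trans r< (≤-trans (s≤s (m≤n+m out m)) m+out≤b)) (<⇒≢ r<)) p

compile-complete : (f : Rec n) (ins : Vec ℕ n) (out b : ℕ) (s : State) {y : ℕ} →
  All (_< b) ins → out < b → f ⟦ Vec.map s ins ⟧⇓ y →
  ∃[ s′ ] ⟦ compile f ins out b ⟧ s s′ × s′ out ≡ y
compileAll-complete : (gs : Vec (Rec n) m) (ins : Vec ℕ n) (out b : ℕ) (s : State)
  {ys : Vec ℕ m} → All (_< out) ins → m + out ≤ b →
  (∀ j → lookup gs j ⟦ Vec.map s ins ⟧⇓ lookup ys j) →
  ∃[ s′ ] ⟦ compileAll gs ins out b ⟧ s s′ × Vec.map s′ (block out m) ≡ ys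

compile-complete zer ins out b s _ _ zer =
  _ , (tt , refl) , exec-≔ out null s
compile-complete succ (r ∷ []) out b s _ _ succ =
  _ , (tt , refl) , exec-≔ out (incr r) s
compile-complete (proj i) ins out b s _ _ (proj .i) =
  _ , (tt , refl) ,
  trans (exec-≔ out (copy (lookup ins i)) s) (sym (lookup-map i s ins))
compile-complete (comp {m = m} f gs) ins out b s ins<b out<b (comp {ys = ys} ds d)
  with u , p , refl ← compileAll-complete gs ins b (m + b) s {ys} ins<b ≤-refl ds =
  let s′ , q , eq = compile-complete f (block b m) out (m + b) u
                      (block-< b m) (weaken m out<b) d
  in s′ , (u , p , q) , eq
compile-complete (prec f g) (r ∷ ins) out b s {y} (r<b ∷ ins<b) out<b d =
  let u₁ , p , u₂ , ps , u₂≈s , eqᵢ , eqₐ = run d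
  in _ , (u₁ , p , _ , (tt , refl) , u₂ , ps , _ ,
          (trans eqᵢ (sym (u₂≈s r<b)) , refl) , tt , refl) ,
     trans (exec-≔ out (copy (1 + b)) u₂) eqₐ
  where
  run : ∀ {x y} → prec f g ⟦ x ∷ Vec.map s ins ⟧⇓ y →
    ∃[ u ] ⟦ compile f ins (1 + b) (2 + b) ⟧ s u ×
    ∃[ v ] ⟦ loop (precBody g ins b) ⟧ (exec (b ≔ null) u) v ×
           v ≈[ b ] s × v b ≡ x × v (1 + b) ≡ y
  run (prec₀ d) =
    let u , p , eq = compile-complete f ins (1 + b) (2 + b) s
                       (weakenAll 2 ins<b) (n<1+n (1 + b)) d
    in u , p , _ , nil ,
       ≈-trans (set-≈ b null u) (λ r<b → scratch-≈ f ins b p (m<n⇒m<1+n r<b)) ,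
       exec-≔ b null u , trans (exec-≔-other null u 1+n≢n) eq
  run (precₛ d e) with u , p , v , ps , v≈s , refl , refl ← run d =
    let w , q , eq = compile-complete g (b ∷ 1 + b ∷ ins) (1 + b) (2 + b) v
                       (m<n⇒m<1+n (n<1+n b) ∷ n<1+n (1 + b) ∷ weakenAll 2 ins<b)
                       (n<1+n (1 + b))
                       (subst (λ xs → g ⟦ v b ∷ v (1 + b) ∷ xs ⟧⇓ _)
                         (sym (map-≈ ins<b v≈s)) e)
        w≈v = scratch-≈ g _ b q
    -- The derivation recurses on the earlier rounds, so the new round is appended at the end of the
    -- loop.
    in u , p , _ , ps ◅◅ (w , q , tt , refl) ◅ nil ,
       ≈-trans (set-≈ b _ w) (≈-trans (λ r<b → w≈v (m<n⇒m<1+n r<b)) v≈s) ,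
       trans (exec-≔ b (incr b) w) (cong suc (w≈v (n<1+n b))) ,
       trans (exec-≔-other (incr b) w 1+n≢n) eq
compile-complete (μ f) ins out b s ins<b out<b (μ {x = x} below d) =
  let u , ps , u≈s , uᵢ = run x ≤-refl
      v , p , eq = call u≈s uᵢ d
  in _ , (_ , (tt , refl) , u , ps , v , p , _ ,
          (subst (λ y → (y ≡ᵇ 0) ≡ true) (sym eq) refl , refl) , tt , refl) ,
     trans (exec-≔ out (copy b) v) (trans (scratch-≈ f (b ∷ ins) b p (n<1+n b)) uᵢ)
  where
  call : ∀ {u w y} → u ≈[ b ] s → u b ≡ w → f ⟦ w ∷ Vec.map s ins ⟧⇓ y →
    ∃[ v ] ⟦ compile f (b ∷ ins) (1 + b) (2 + b) ⟧ u v × v (1 + b) ≡ y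
  call {u} u≈s refl d = compile-complete f (b ∷ ins) (1 + b) (2 + b) u
    (m<n⇒m<1+n (n<1+n b) ∷ weakenAll 2 ins<b) (n<1+n (1 + b))
    (subst (λ xs → f ⟦ u b ∷ xs ⟧⇓ _) (sym (map-≈ ins<b u≈s)) d)

  run : ∀ w → w ≤ x →
    ∃[ v ] ⟦ loop (μBody f ins b) ⟧ (exec (b ≔ null) s) v × v ≈[ b ] s × v b ≡ w
  run zero    _   = _ , nil , set-≈ b null s , exec-≔ b null s
  run (suc w) w<x =
    let u , ps , u≈s , uᵢ = run w (<⇒≤ w<x)
        y , d             = below w<x
        v , p , eq        = call u≈s uᵢ d
        v≈u               = scratch-≈ f (b ∷ ins) b p
    in _ , ps ◅◅ (v , p , _ , (subst (λ y → (y ≡ᵇ 0) ≡ false) (sym eq) refl , refl) ,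
                  tt , refl) ◅ nil ,
       ≈-trans (set-≈ b _ v) (≈-trans (λ r<b → v≈u (m<n⇒m<1+n r<b)) u≈s) ,
       trans (exec-≔ b (incr b) v) (cong suc (trans (v≈u (n<1+n b)) uᵢ))

compileAll-complete []       ins out b s {[]} _ _ _ = s , (refl , refl) , refl
compileAll-complete {m = suc m} (g ∷ gs) ins out b s {y ∷ ys} ins<out m+out≤b ds =
  let u , p , eq  = compile-complete g ins out b s (All.map (λ r< → <-trans r< out<b) ins<out)
                      out<b (ds zero)
      u≈s         = avoided-≈ (compile g ins out b)
                      (λ r< → compile-avoids g ins out b (<-trans r< out<b) (<⇒≢ r<)) p
      s′ , q , eqs = compileAll-complete gs ins (suc out) b u
                      (All.map m<n⇒m<1+n ins<out)
                      (≤-trans (≤-reflexive (+-suc m out)) m+out≤b)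
                      (λ j → subst (λ xs → lookup gs j ⟦ xs ⟧⇓ lookup ys j)
                        (sym (map-≈ ins<out u≈s)) (ds (suc j)))
  in s′ , (u , p , q) ,
     cong₂ _∷_ (trans (avoided (compileAll gs ins (suc out) b)
                        (compileAll-avoids gs ins (suc out) b out<b (n<1+n out)) q) eq)
               eqs
  where
  out<b : out < b
  out<b = ≤-trans (s≤s (m≤n+m out m)) m+out≤b

-- Flow graphs of programs

input : ℕ → State
input x zero    = x
input x (suc _) = 0

-- Register 0 holds the input, register 1 the guessed witness and register 2 the verdict; scratch
-- space starts at 3.
search : Rec 2 → Program
search c =
  loop (op (1 ≔ incr 1)) ⨾ compile c (0 ∷ 1 ∷ []) 2 3 ⨾ op (test 2 false)

private
  args<3 : All (_< 3) (0 ∷ 1 ∷ [])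
  args<3 = s≤s z≤n ∷ s≤s (s≤s z≤n) ∷ []

search-sound : ∀ (χ : ℕ → ℕ → Bool) c → (∀ x y → c ⟦ x ∷ y ∷ [] ⟧⇓ (if χ x y then 1 else 0)) →
  ∀ {x s} → ⟦ search c ⟧ (input x) s → ∃[ y ] T (χ x y)
search-sound χ c computes {x} (u , ps , v , p , (nonzero , refl)) =
  u 1 , accepts _ (subst (λ z → (z ≡ᵇ 0) ≡ false) value≡ nonzero)
  where
  u₀≡x : u 0 ≡ x
  u₀≡x = avoided (loop (op (1 ≔ incr 1))) {0} (λ ()) ps

  value≡ : v 2 ≡ (if χ x (u 1) then 1 else 0)
  value≡ = ⇓-functional c
    (subst (λ w → c ⟦ w ∷ u 1 ∷ [] ⟧⇓ v 2) u₀≡x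
      (compile-sound c (0 ∷ 1 ∷ []) 2 3 args<3 ≤-refl p))
    (computes x (u 1))

  accepts : ∀ b → ((if b then 1 else 0) ≡ᵇ 0) ≡ false → T b
  accepts true _ = tt

search-complete : ∀ (χ : ℕ → ℕ → Bool) c → (∀ x y → c ⟦ x ∷ y ∷ [] ⟧⇓ (if χ x y then 1 else 0)) →
  ∀ {x y} → T (χ x y) → ∃[ s ] ⟦ search c ⟧ (input x) s
search-complete χ c computes {x} {y} χxy =
  let u , ps , u₀ , u₁ = guess y
      v , p , eq = compile-complete c (0 ∷ 1 ∷ []) 2 3 u args<3 ≤-refl
        (subst₂ (λ w z → c ⟦ w ∷ z ∷ [] ⟧⇓ (if χ x y then 1 else 0)) (sym u₀) (sym u₁)
          (computes x y))
  in v , u , ps , v , p ,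
     subst (λ z → (z ≡ᵇ 0) ≡ false) (sym eq) (accepted (χ x y) χxy) , refl
  where
  accepted : ∀ b → T b → ((if b then 1 else 0) ≡ᵇ 0) ≡ false
  accepted true _ = refl

  guess : ∀ y → ∃[ u ] ⟦ loop (op (1 ≔ incr 1)) ⟧ (input x) u × u 0 ≡ x × u 1 ≡ y
  guess zero    = input x , nil , refl , refl
  guess (suc y) = let u , ps , u₀ , u₁ = guess y
                  in _ , ps ◅◅ (tt , refl) ◅ nil , u₀ , cong suc u₁

record Transition : Set where
  constructor _─_⟶_
  field
    from   : ℕ
    action : Op
    to     : ℕ

open Transition public

infix 4 _─_⟶_

exit : Program → ℕ → ℕ
exit (op o)   n = suc n
exit (P ⨾ Q)  n = exit Q (exit P n)
exit (loop P) n = suc (exit P (suc n))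

code : Program → ℕ → List Transition
code (op o)   n = (n ─ o ⟶ suc n) ∷ []
code (P ⨾ Q)  n = code P n ++ code Q (exit P n)
code (loop P) n =
  (n ─ skip ⟶ suc n) ∷ (n ─ skip ⟶ exit (loop P) n) ∷
  (exit P (suc n) ─ skip ⟶ n) ∷ code P (suc n)

n<exit : ∀ P n → n < exit P n
n<exit (op o)   n = n<1+n n
n<exit (P ⨾ Q)  n = <-trans (n<exit P n) (n<exit Q _)
n<exit (loop P) n = <-trans (n<1+n n) (m<n⇒m<1+n (n<exit P (suc n)))

code-range : ∀ P n {τ} → τ ∈ₗ code P n → n ≤ from τ × from τ < exit P n
code-range (op o)   n (here refl) = ≤-refl , n<1+n n
code-range (P ⨾ Q)  n τ∈ with ∈-++⁻ (code P n) τ∈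
... | inj₁ τ∈P = let l , u = code-range P n τ∈P
                 in l , <-trans u (n<exit Q _)
... | inj₂ τ∈Q = let l , u = code-range Q _ τ∈Q
                 in ≤-trans (<⇒≤ (n<exit P n)) l , u
code-range (loop P) n (here refl)                 = ≤-refl , n<exit (loop P) n
code-range (loop P) n (there (here refl))         = ≤-refl , n<exit (loop P) n
code-range (loop P) n (there (there (here refl))) =
  <⇒≤ (<-trans (n<1+n n) (n<exit P (suc n))) , n<1+n _
code-range (loop P) n (there (there (there τ∈)))  =
  let l , u = code-range P (suc n) τ∈ in <⇒≤ l , m<n⇒m<1+n u

-- The length index gives the moment at which the `U` formula is fulfilled and bounds the recursion
-- through loops.
data Halts (Γ : List Transition) (h : ℕ) : ℕ → ℕ → State → Set where
  halt : ∀ {s} → Halts Γ h 0 h s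
  step : ∀ {l q o q′ s} → (q ─ o ⟶ q′) ∈ₗ Γ → Guard o s →
         Halts Γ h l q′ (exec o s) → Halts Γ h (suc l) q s

-- Halting runs of a flow graph versus executions of its program

module _ {Γ : List Transition} {h : ℕ} where

  -- Blocks of code occupy disjoint intervals of locations. This condition, stated for the whole
  -- graph, leaves the exit as the only way out of a block.
  Owns : Program → ℕ → Set
  Owns P n = ∀ {τ} → τ ∈ₗ Γ → n ≤ from τ → from τ < exit P n → τ ∈ₗ code P n

  -- As `h` is not below the exit, a halting run cannot end inside the block and has to complete an
  -- execution of `P`. The remainder is not a subterm of the run, so loops recurse on a bound `k`
  -- for its length.
  halts-prefix : ∀ P n {l s} → Owns P n → exit P n ≤ h → Halts Γ h l n s →
    ∃[ s′ ] ⟦ P ⟧ s s′ × ∃[ l′ ] l′ ≤ l × Halts Γ h l′ (exit P n) s′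
  loop-prefix : ∀ P n k {l s} → l ≤ k → Owns (loop P) n → exit (loop P) n ≤ h →
    Halts Γ h l n s →
    ∃[ s′ ] ⟦ loop P ⟧ s s′ × ∃[ l′ ] l′ ≤ l × Halts Γ h l′ (exit (loop P) n) s′

  halts-prefix (op o) n owns n<h halt = contradiction n<h (<-irrefl refl)
  halts-prefix (op o) n owns n<h (step τ∈ g r) with here refl ← owns τ∈ ≤-refl (n<1+n n) =
    _ , (g , refl) , _ , n≤1+n _ , r
  halts-prefix (P ⨾ Q) n owns e≤h r =
    let u , p , l′ , l′≤ , r′ = halts-prefix P n ownsP (≤-trans (<⇒≤ (n<exit Q _)) e≤h) r
        v , q , l″ , l″≤ , r″ = halts-prefix Q _ ownsQ e≤h r′
    in v , (u , p , q) , l″ , ≤-trans l″≤ l′≤ , r″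
    where
    ownsP : Owns P n
    ownsP τ∈ l u with ∈-++⁻ (code P n) (owns τ∈ l (<-trans u (n<exit Q _)))
    ... | inj₁ τ∈P = τ∈P
    ... | inj₂ τ∈Q = contradiction (<-≤-trans u (proj₁ (code-range Q _ τ∈Q))) (<-irrefl refl)
    ownsQ : Owns Q (exit P n)
    ownsQ τ∈ l u with ∈-++⁻ (code P n) (owns τ∈ (≤-trans (<⇒≤ (n<exit P n)) l) u)
    ... | inj₁ τ∈P = contradiction (<-≤-trans (proj₂ (code-range P n τ∈P)) l) (<-irrefl refl)
    ... | inj₂ τ∈Q = τ∈Q
  halts-prefix (loop P) n owns e≤h r = loop-prefix P n _ ≤-refl owns e≤h r

  loop-prefix P n k l≤k owns e≤h halt =
    contradiction (<-≤-trans (n<exit (loop P) n) e≤h) (<-irrefl refl)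
  loop-prefix P n (suc k) (s≤s l≤k) owns e≤h (step τ∈ g r)
    with owns τ∈ ≤-refl (n<exit (loop P) n)
  ... | there (here refl) = _ , nil , _ , n≤1+n _ , r
  ... | there (there (here eq)) =
    contradiction (cong from eq) (<⇒≢ (<-trans (n<1+n n) (n<exit P (suc n))))
  ... | there (there (there τ∈P)) =
    contradiction (proj₁ (code-range P (suc n) τ∈P)) (<-irrefl refl)
  ... | here refl =
    let u , p , l′ , l′≤ , r′ = halts-prefix P (suc n) owns′ (<⇒≤ e≤h) r
    in continue p r′ l′≤ l≤k
    where
    n<e : n < exit P (suc n)
    n<e = <-trans (n<1+n n) (n<exit P (suc n))

    owns′ : Owns P (suc n)
    owns′ τ∈ l u with owns τ∈ (<⇒≤ l) (m<n⇒m<1+n u)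
    ... | here refl                 = contradiction l (<-irrefl refl)
    ... | there (here refl)         = contradiction l (<-irrefl refl)
    ... | there (there (here refl)) = contradiction u (<-irrefl refl)
    ... | there (there (there τ∈P)) = τ∈P

    continue : ∀ {s u l l′} → ⟦ P ⟧ s u → Halts Γ h l′ (exit P (suc n)) u → l′ ≤ l → l ≤ k →
      ∃[ s′ ] ⟦ loop P ⟧ s s′ × ∃[ l′ ] l′ ≤ suc l × Halts Γ h l′ (exit (loop P) n) s′
    continue p halt _ _ = contradiction e≤h (<-irrefl refl)
    continue p (step τ∈ g r) l′≤l l≤k
      with owns τ∈ (<⇒≤ n<e) (n<1+n _)
    ... | here eq = contradiction (cong from eq) (>⇒≢ n<e)
    ... | there (here eq) = contradiction (cong from eq) (>⇒≢ n<e)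
    ... | there (there (there τ∈P)) =
      contradiction (proj₂ (code-range P (suc n) τ∈P)) (<-irrefl refl)
    ... | there (there (here refl)) =
      let v , ps , l″ , l″≤ , r″ = loop-prefix P n k (≤-trans (<⇒≤ l′≤l) l≤k) owns e≤h r
      in v , p ◅ ps , l″ , ≤-trans l″≤ (≤-trans (n≤1+n _) (m≤n⇒m≤1+n l′≤l)) , r″

  -- A halting run is built from its end; executions are therefore prepended to a run that starts at
  -- the exit.
  halts-extend : ∀ P n {l s s′} → (∀ {τ} → τ ∈ₗ code P n → τ ∈ₗ Γ) → ⟦ P ⟧ s s′ →
    Halts Γ h l (exit P n) s′ → ∃[ l′ ] Halts Γ h l′ n s
  halts-extend (op o)   n ⊆Γ (g , refl)   r = _ , step (⊆Γ (here refl)) g r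
  halts-extend (P ⨾ Q)  n ⊆Γ (u , p , q)  r =
    let _ , r′ = halts-extend Q _ (λ τ∈ → ⊆Γ (∈-++⁺ʳ (code P n) τ∈)) q r
    in halts-extend P n (λ τ∈ → ⊆Γ (∈-++⁺ˡ τ∈)) p r′
  halts-extend (loop P) n ⊆Γ nil            r = _ , step (⊆Γ (there (here refl))) refl r
  halts-extend (loop P) n ⊆Γ (p ◅ ps)     r =
    let _ , r′ = halts-extend (loop P) n ⊆Γ ps r
        _ , r″ = halts-extend P (suc n) (λ τ∈ → ⊆Γ (there (there (there τ∈)))) p
                   (step (⊆Γ (there (there (here refl)))) refl r′)
    in _ , step (⊆Γ (here refl)) refl r″

halts⇔ : ∀ P s → (∃[ l ] Halts (code P 0) (exit P 0) l 0 s) ⇔ (∃[ s′ ] ⟦ P ⟧ s s′)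
halts⇔ P s = mk⇔
  (λ (_ , r) → let s′ , p , _ = halts-prefix P 0 (λ τ∈ _ _ → τ∈) ≤-refl r in s′ , p)
  (λ (_ , p) → halts-extend P 0 (λ τ∈ → τ∈) p halt)

-- Configurations as traces

-- The formulas for which team semantics is flat and both semantics agree,
-- constructively.
data Local (k : ℕ) : Set where
  lit : Fin k → Bool → Local k
  _∧_ : Local k → Local k → Local k
  _∨_ : Local k → Local k → Local k
  X   : Local k → Local k

Holds : Trace k → ℕ → Local k → Set
Holds t i (lit p b) = lookup (t i) p ≡ b
Holds t i (φ ∧ ψ)   = Holds t i φ × Holds t i ψ
Holds t i (φ ∨ ψ)   = Holds t i φ ⊎ Holds t i ψ
Holds t i (X φ)     = Holds t (suc i) φ

ltl : Local k → LTL k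
ltl (lit p true)  = atom p
ltl (lit p false) = natom p
ltl (φ ∧ ψ)       = ltl φ ∧ ltl ψ
ltl (φ ∨ ψ)       = ltl φ ∨ ltl ψ
ltl (X φ)         = X (ltl φ)

team : Local k → TeamLTL k
team (lit p true)  = atom p
team (lit p false) = natom p
team (φ ∧ ψ)       = team φ ∧ team ψ
team (φ ∨ ψ)       = team φ ∨ team ψ
team (X φ)         = X (team φ)

Holds⇒ltl : ∀ (φ : Local k) {t i} → Holds t i φ → t ∣ i ⊩ ltl φ
Holds⇒ltl (lit p true)  h        = lookup⇒[]= p _ h
Holds⇒ltl (lit p false) h        = λ p∈ → contradiction (trans (sym ([]=⇒lookup p∈)) h) λ ()
Holds⇒ltl (φ ∧ ψ)       (a , b)  = Holds⇒ltl φ a , Holds⇒ltl ψ b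
Holds⇒ltl (φ ∨ ψ)       (inj₁ a) = inj₁ (Holds⇒ltl φ a)
Holds⇒ltl (φ ∨ ψ)       (inj₂ b) = inj₂ (Holds⇒ltl ψ b)
Holds⇒ltl (X φ)         h        = Holds⇒ltl φ h

ltl⇒Holds : ∀ (φ : Local k) {t i} → t ∣ i ⊩ ltl φ → Holds t i φ
ltl⇒Holds (lit p true)  h        = []=⇒lookup h
ltl⇒Holds (lit p false) {t} {i} h = ¬-not (h ∘ lookup⇒[]= p (t i))
ltl⇒Holds (φ ∧ ψ)       (a , b)  = ltl⇒Holds φ a , ltl⇒Holds ψ b
ltl⇒Holds (φ ∨ ψ)       (inj₁ a) = inj₁ (ltl⇒Holds φ a)
ltl⇒Holds (φ ∨ ψ)       (inj₂ b) = inj₂ (ltl⇒Holds ψ b)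
ltl⇒Holds (X φ)         h        = ltl⇒Holds φ h

Holds⇒team : ∀ (φ : Local k) {S : TraceSet k} {i} → (∀ t → S t → Holds t i φ) → S ∣ i ⊨ team φ
Holds⇒team (lit p true)  h = lift λ t St → Holds⇒ltl (lit p true) {t} (h t St)
Holds⇒team (lit p false) h = lift λ t St → Holds⇒ltl (lit p false) {t} (h t St)
Holds⇒team (φ ∧ ψ)       h =
  Holds⇒team φ (λ t St → proj₁ (h t St)) , Holds⇒team ψ (λ t St → proj₂ (h t St))
Holds⇒team (φ ∨ ψ) {S} {i} h =
  (λ t → S t × Holds t i φ) , (λ t → S t × Holds t i ψ) ,
  ([ proj₁ , proj₁ ]′ , λ {t} St → [ inj₁ ∘ (St ,_) , inj₂ ∘ (St ,_) ]′ (h t St)) ,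
  Holds⇒team φ (λ _ → proj₂) , Holds⇒team ψ (λ _ → proj₂)
Holds⇒team (X φ)         h = Holds⇒team φ h

team⇒Holds : ∀ (φ : Local k) {S : TraceSet k} {i} → S ∣ i ⊨ team φ → ∀ {t} → S t → Holds t i φ
team⇒Holds (lit p true)  h {t} St = ltl⇒Holds (lit p true) {t} (lower h _ St)
team⇒Holds (lit p false) h {t} St = ltl⇒Holds (lit p false) {t} (lower h _ St)
team⇒Holds (φ ∧ ψ) (a , b) St = team⇒Holds φ a St , team⇒Holds ψ b St
team⇒Holds (φ ∨ ψ) (_ , _ , (_ , S⊆) , a , b) St with S⊆ St
... | inj₁ S₁t = inj₁ (team⇒Holds φ a S₁t)
... | inj₂ S₂t = inj₂ (team⇒Holds ψ b S₂t)
team⇒Holds (X φ) h St = team⇒Holds φ h St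

Holds-resp : ∀ (φ : Local k) {t t′ : Trace k} → (∀ i → t i ≡ t′ i) → ∀ {i} →
  Holds t′ i φ → Holds t i φ
Holds-resp (lit p b) eq {i} h        = trans (cong (λ v → lookup v p) (eq i)) h
Holds-resp (φ ∧ ψ)   eq     (a , b)  = Holds-resp φ eq a , Holds-resp ψ eq b
Holds-resp (φ ∨ ψ)   eq     (inj₁ a) = inj₁ (Holds-resp φ eq a)
Holds-resp (φ ∨ ψ)   eq     (inj₂ b) = inj₂ (Holds-resp ψ eq b)
Holds-resp (X φ)     eq     h        = Holds-resp φ eq h

absurd : Local (suc k)
absurd = lit zero true ∧ lit zero false

¬absurd : ∀ {t : Trace (suc k)} {i} → ¬ Holds t i absurd
¬absurd (a , b) with () ← trans (sym a) b

□ : TeamLTL (suc k) → TeamLTL (suc k)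
□ φ = φ W team absurd

□⁺ : ∀ (φ : TeamLTL (suc k)) {S i} → (∀ {l} → i ≤ l → S ∣ l ⊨ φ) → S ∣ i ⊨ □ φ
□⁺ φ h l i≤l = inj₁ (h i≤l)

-- The empty team satisfies every □ φ, whence the member t.
□⁻ : ∀ (φ : TeamLTL (suc k)) {S i t} → S t → S ∣ i ⊨ □ φ → ∀ {l} → i ≤ l → S ∣ l ⊨ φ
□⁻ φ {t = t} St h {l} i≤l with h l i≤l
... | inj₁ ok              = ok
... | inj₂ (j , _ , _ , f) = contradiction (team⇒Holds absurd f St) (¬absurd {t = t} {j})

-- Numbers as distances to a mark

next : ℕ → Local k → Local k
next zero    φ = φ
next (suc d) φ = next d (X φ)

next⁺ : ∀ d (φ : Local k) {t i} → Holds t (d + i) φ → Holds t i (next d φ)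
next⁺ zero    φ h = h
next⁺ (suc d) φ h = next⁺ d (X φ) h

next⁻ : ∀ d (φ : Local k) {t i} → Holds t i (next d φ) → Holds t (d + i) φ
next⁻ zero    φ h = h
next⁻ (suc d) φ h = next⁻ d (X φ) h

first : Fin k → ℕ → Local k
first p zero    = lit p true
first p (suc n) = lit p false ∧ X (first p n)

first-unique : ∀ {t : Trace k} {i} p m n → Holds t i (first p m) → Holds t i (first p n) → m ≡ n
first-unique p zero    zero    _       _       = refl
first-unique p (suc m) (suc n) (_ , a) (_ , b) = cong suc (first-unique p m n a b)
first-unique p zero    (suc n) a       (b , _) with () ← trans (sym a) b
first-unique p (suc m) zero    (a , _) b       with () ← trans (sym a) b

first-shift : ∀ {t t′ : Trace k} {p p′} d {i} n →
  (∀ {l} → i ≤ l → lookup (t l) p ≡ lookup (t′ (d + l)) p′) →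
  Holds t i (first p n) → Holds t′ (d + i) (first p′ n)
first-shift d zero    eq a       = trans (sym (eq ≤-refl)) a
first-shift {t′ = t′} {p′ = p′} d {i} (suc n) eq (a , b) =
  trans (sym (eq ≤-refl)) a ,
  subst (λ l → Holds t′ l (first p′ n)) (+-suc d i)
    (first-shift d n (λ i<l → eq (<⇒≤ i<l)) b)

≡ᵇ-refl : ∀ n → (n ≡ᵇ n) ≡ true
≡ᵇ-refl n = Equivalence.to T-≡ (≡⇒≡ᵇ n n refl)

≢⇒≡ᵇ-false : ∀ {m n} → m ≢ n → (m ≡ᵇ n) ≡ false
≢⇒≡ᵇ-false {m} {n} m≢n = ¬-not (m≢n ∘ ≡ᵇ⇒≡ m n ∘ Equivalence.from T-≡)

first-single : ∀ {t : Trace k} {p} a n → (∀ {l} → a ≤ l → lookup (t l) p ≡ (l ≡ᵇ a + n)) →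
  Holds t a (first p n)
first-single a zero    h = trans (h ≤-refl)
  (trans (cong (a ≡ᵇ_) (+-identityʳ a)) (≡ᵇ-refl a))
first-single a (suc n) h =
  trans (h ≤-refl) (≢⇒≡ᵇ-false (<⇒≢ (m<m+n a (s≤s z≤n)))) ,
  first-single (suc a) n (λ {l} a<l → trans (h (<⇒≤ a<l)) (cong (l ≡ᵇ_) (+-suc a n)))

-- Makes `reg` total, so that formulas may mention arbitrary register numbers; only those up to `m`
-- are kept apart.
clamp : ∀ m → ℕ → Fin (suc m)
clamp m       zero    = zero
clamp zero    (suc _) = zero
clamp (suc m) (suc r) = suc (clamp m r)

toℕ-clamp : ∀ {m r} → r < suc m → toℕ (clamp m r) ≡ r
toℕ-clamp {m}     {zero}  _         = refl
toℕ-clamp {suc m} {suc r} (s≤s r<m) = cong suc (toℕ-clamp r<m)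
toℕ-clamp {zero}  {suc r} (s≤s ())

-- A configuration that is current at time i is a trace on which act marks i,
-- and on which location and registers are stored as the distance from i to
-- the first mark of loc and of reg r.  The bit dir is constant along a trace
-- and alternates between successive configurations.
module Encoding (m : ℕ) where

  ini act dir loc : Fin (5 + m)
  ini = zero
  act = suc zero
  dir = suc (suc zero)
  loc = suc (suc (suc zero))

  reg : ℕ → Fin (5 + m)
  reg r = suc (suc (suc (suc (clamp m r))))

  registers : List ℕ
  registers = upTo (suc m)

  -- Every split-off trace takes one of two roles. Activity reveals the role at the moment of the
  -- step; tying it to `dir` keeps it recognisable later.
  ends : Bool → ℕ → ℕ → Local (5 + m)
  ends ε q q′ =
    ((lit act true  ∧ X (lit act false)) ∧ (lit dir ε       ∧ first loc q)) ∨
    ((lit act false ∧ X (lit act true))  ∧ (lit dir (not ε) ∧ X (first loc q′)))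

  steady : Local (5 + m)
  steady = (lit dir true ∧ X (lit dir true)) ∨ (lit dir false ∧ X (lit dir false))

  -- Both registers lie on one trace, so here a splitting disjunction suffices for the comparison.
  same : Bool → ℕ → ℕ → Local (5 + m)
  same ε r r′ =
    lit dir (not ε) ∨
    ((lit (reg r) true ∧ lit (reg r′) true) ∨ (lit (reg r) false ∧ lit (reg r′) false))

  -- An assignment has no guard; □ (team steady) is required of the pair anyway.
  guard : Bool → Op → TeamLTL (5 + m)
  guard ε (_ ≔ _)    = □ (team steady)
  guard ε (test r b) = team (lit act false ∨ lit (reg r) b)
  guard ε (r == r′)  = □ (team (same ε r r′))

  shifted : Bool → ℕ → ℕ → ℕ → Bool → Local (5 + m)
  shifted ε d r r′ b =
    (lit dir ε ∧ lit (reg r) b) ∨ (lit dir (not ε) ∧ next d (lit (reg r′) b))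

  shift : Bool → ℕ → ℕ → ℕ → TeamLTL (5 + m)
  shift ε d r r′ = □ (team (shifted ε d r r′ true) ∨ᴮ team (shifted ε d r r′ false))

  update : Bool → Source → ℕ → TeamLTL (5 + m)
  update ε null     r = team (lit act true ∨ X (lit (reg r) true))
  update ε (copy r′) r = shift ε 1 r′ r
  -- A shift by two constrains the new trace only from the position after its activation; the
  -- activation itself must be kept free of a mark separately.
  update ε (incr r′) r = team (lit act true ∨ X (lit (reg r) false)) ∧ shift ε 2 r′ r

  updates : Bool → Op → List ℕ → TeamLTL (5 + m)
  updates ε o = foldr (λ r φ → update ε (source o r) r ∧ φ) (□ (team steady))

  related : Bool → Transition → TeamLTL (5 + m)
  related ε (q ─ o ⟶ q′) = team (ends ε q q′) ∧ (guard ε o ∧ updates ε o registers)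

  inactive : Local (5 + m)
  inactive = lit act false ∧ X (lit act false)

  move : Bool → Transition → TeamLTL (5 + m)
  move ε τ = related ε τ ∨ team inactive

  -- The choice is Boolean, so one transition serves all active traces. Both directions are offered
  -- because the same formula is used at steps of either parity.
  moves : List Transition → TeamLTL (5 + m)
  moves = foldr (λ τ φ → (move true τ ∨ᴮ move false τ) ∨ᴮ φ) (team absurd)

  successor : List Transition → TeamLTL (5 + m)
  successor Γ = ((atom act ∷ []) ⊆ (X (atom act) ∷ [])) ∧ moves Γ

  stopped : ℕ → Local (5 + m)
  stopped h = lit act false ∨ first loc h

  zeroed : Local (5 + m)
  zeroed = foldr (λ r φ → lit (reg (suc r)) true ∧ φ) (lit act true ∧ lit loc true) (upTo m)

  starting : ℕ → Local (5 + m)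
  starting x = first (reg 0) x ∧ zeroed

  -- Time zero shows the fixed label of the initial state, time one separates the trap by `ini`, and
  -- configuration zero becomes active at time two.
  simulation : List Transition → ℕ → ℕ → TeamLTL (5 + m)
  simulation Γ h x =
    X (((atom ini ∷ []) ⊆ (X (ltl (starting x)) ∷ [])) ∧ X (successor Γ U team (stopped h)))
    ∨ X (natom ini)

  -- Reading a halting run off a satisfying team

  record Encodes (t : Trace (5 + m)) (i q : ℕ) (s : State) : Set where
    field
      active    : Holds t i (lit act true)
      location  : Holds t i (first loc q)
      register  : ∀ {r} → r < suc m → Holds t i (first (reg r) (s r))

  open Encodes

  InRange : Source → Set
  InRange null     = ⊤
  InRange (copy r) = r < suc m
  InRange (incr r) = r < suc m

  Bounded : Op → Set
  Bounded (r ≔ e)    = InRange e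
  Bounded (test r _) = r < suc m
  Bounded (r == r′)  = r < suc m × r′ < suc m

  source-inRange : ∀ o {r} → Bounded o → r < suc m → InRange (source o r)
  source-inRange (r′ ≔ e) {r} e-ok r<m with does (r ≟ r′)
  ... | true  = e-ok
  ... | false = r<m
  source-inRange (test _ _) _ r<m = r<m
  source-inRange (_ == _)   _ r<m = r<m

  first-zero : ∀ {t : Trace (5 + m)} {i p} n → Holds t i (first p n) → lookup (t i) p ≡ (n ≡ᵇ 0)
  first-zero zero    a       = a
  first-zero (suc n) (a , _) = a

  steady-forever : ∀ {S : TraceSet (5 + m)} {i t b} → S t → S ∣ i ⊨ □ (team steady) →
    lookup (t i) dir ≡ b → ∀ {l} → i ≤ l → lookup (t l) dir ≡ b
  steady-forever {S} {i} {t} {b} St f now i≤l = go (≤⇒≤′ i≤l)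
    where
    go : ∀ {l} → i ≤′ l → lookup (t l) dir ≡ b
    go ≤′-refl       = now
    go (≤′-step i≤′l) with team⇒Holds steady (□⁻ (team steady) St f (≤′⇒≤ i≤′l)) St
    ... | inj₁ (x , y) = trans y (trans (sym x) (go i≤′l))
    ... | inj₂ (x , y) = trans y (trans (sym x) (go i≤′l))

  module Pair {S : TraceSet (5 + m)} {i t t′ q s} (ε : Bool) (St : S t) (St′ : S t′)
    (enc : Encodes t i q s)
    (inactive′ : Holds t′ i (lit act false))
    (dir-t  : ∀ {l} → i ≤ l → lookup (t l) dir ≡ ε)
    (dir-t′ : ∀ {l} → i ≤ l → lookup (t′ l) dir ≡ not ε) where

    shift-sound : ∀ d r r′ → S ∣ i ⊨ shift ε d r r′ →
      ∀ {l} → i ≤ l → lookup (t l) (reg r) ≡ lookup (t′ (d + l)) (reg r′)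
    shift-sound d r r′ f {l} i≤l =
      [ agree true , agree false ]′
        (□⁻ (team (shifted ε d r r′ true) ∨ᴮ team (shifted ε d r r′ false)) St f i≤l)
      where
      agree : ∀ b → S ∣ l ⊨ team (shifted ε d r r′ b) →
        lookup (t l) (reg r) ≡ lookup (t′ (d + l)) (reg r′)
      agree b g with team⇒Holds (shifted ε d r r′ b) g St | team⇒Holds (shifted ε d r r′ b) g St′
      -- The direction bits exclude the swapped roles, so the common bit `b` is read off the old
      -- trace at `l` and off the new one at `d + l`.
      ... | inj₂ (a , _) | _            = contradiction a (not-¬ (dir-t i≤l))
      ... | inj₁ _       | inj₁ (a , _) = contradiction (dir-t′ i≤l) (not-¬ a)
      ... | inj₁ (_ , a) | inj₂ (_ , c) = trans a (sym (next⁻ d (lit (reg r′) b) c))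

    update-sound : ∀ e r → InRange e → S ∣ i ⊨ update ε e r →
      Holds t′ (suc i) (first (reg r) (value e s))
    update-sound null r _ f with team⇒Holds (lit act true ∨ X (lit (reg r) true)) f St′
    ... | inj₁ a = contradiction inactive′ (not-¬ a)
    ... | inj₂ a = a
    update-sound (copy r′) r r′<m f =
      first-shift 1 (s r′) (shift-sound 1 r′ r f) (register enc r′<m)
    update-sound (incr r′) r r′<m (f , g)
      with team⇒Holds (lit act true ∨ X (lit (reg r) false)) f St′
    ... | inj₁ a = contradiction inactive′ (not-¬ a)
    ... | inj₂ a = a , first-shift 2 (s r′) (shift-sound 2 r′ r g) (register enc r′<m)

    updates-sound : ∀ o {r} rs → r ∈ₗ rs → S ∣ i ⊨ updates ε o rs → S ∣ i ⊨ update ε (source o r) r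
    updates-sound o (_ ∷ _)  (here refl) (f , _) = f
    updates-sound o (_ ∷ rs) (there r∈)  (_ , f) = updates-sound o rs r∈ f

    guard-sound : ∀ o → Bounded o → S ∣ i ⊨ guard ε o → Guard o s
    guard-sound (_ ≔ _)    _   _ = tt
    guard-sound (test r b) r<m f with team⇒Holds (lit act false ∨ lit (reg r) b) f St
    ... | inj₁ a = contradiction a (not-¬ (active enc))
    ... | inj₂ a = trans (sym (first-zero (s r) (register enc r<m))) a
    guard-sound (r == r′) (r<m , r′<m) f =
      first-unique {t = t} {i} (reg r′) (s r) (s r′)
        (first-shift 0 (s r) agree (register enc r<m)) (register enc r′<m)
      where
      agree : ∀ {l} → i ≤ l → lookup (t l) (reg r) ≡ lookup (t l) (reg r′)
      agree i≤l with team⇒Holds (same ε r r′) (□⁻ (team (same ε r r′)) St f i≤l) St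
      ... | inj₁ a              = contradiction a (not-¬ (dir-t i≤l))
      ... | inj₂ (inj₁ (a , b)) = trans a (sym b)
      ... | inj₂ (inj₂ (a , b)) = trans a (sym b)

  module Soundness (S : TraceSet (5 + m)) (Γ : List Transition) (h : ℕ)
    (bounded : ∀ {τ} → τ ∈ₗ Γ → Bounded (action τ)) where

    data Successor (i q : ℕ) (s : State) : Set where
      reached : ∀ {o q′ t′} → (q ─ o ⟶ q′) ∈ₗ Γ → Guard o s → S t′ →
        Encodes t′ (suc i) q′ (exec o s) → Successor i q s

    moves-sound : ∀ {i t} Δ → S t → S ∣ i ⊨ moves Δ →
      ∃[ τ ] τ ∈ₗ Δ × ∃[ ε ] S ∣ i ⊨ move ε τ
    moves-sound {i} {t} [] St f = contradiction (team⇒Holds absurd f St) (¬absurd {t = t} {i})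
    moves-sound (τ ∷ Δ) St (inj₁ (inj₁ f)) = τ , here refl , true , f
    moves-sound (τ ∷ Δ) St (inj₁ (inj₂ f)) = τ , here refl , false , f
    moves-sound (τ ∷ Δ) St (inj₂ f) =
      let τ , τ∈ , ε , g = moves-sound Δ St f in τ , there τ∈ , ε , g

    steady-updates : ∀ {S i} ε o rs → S ∣ i ⊨ updates ε o rs → S ∣ i ⊨ □ (team steady)
    steady-updates ε o []       f       = f
    steady-updates ε o (_ ∷ rs) (_ , f) = steady-updates ε o rs f

    related-sound : ∀ {S₁ i t t′ q s} ε τ → τ ∈ₗ Γ → S t′ → S₁ t → S₁ t′ → Encodes t i q s →
      Holds t′ (suc i) (lit act true) → S₁ ∣ i ⊨ related ε τ → Successor i q s
    related-sound {S₁} {i} {t} {t′} {q} {s} ε (q₀ ─ o ⟶ q₁) τ∈ St′ S₁t S₁t′ enc act′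
      (f-ends , f-guard , f-updates)
      with team⇒Holds (ends ε q₀ q₁) f-ends S₁t | team⇒Holds (ends ε q₀ q₁) f-ends S₁t′
    ... | inj₂ ((a , _) , _) | _ = contradiction a (not-¬ (active enc))
    ... | inj₁ _ | inj₁ ((_ , a) , _) = contradiction a (not-¬ act′)
    ... | inj₁ (_ , dir-t , loc-t) | inj₂ ((act-t′ , _) , dir-t′ , loc-t′)
      with refl ← first-unique {t = t} {i} loc q₀ q loc-t (location enc) =
      reached τ∈ (guard-sound o (bounded τ∈) f-guard) St′ record
        { active   = act′
        ; location = loc-t′
        ; register = λ {r} r<m → update-sound (source o r) r (source-inRange o (bounded τ∈) r<m)
                       (updates-sound o registers (∈-upTo⁺ r<m) f-updates)
        }
      where
      steady-S₁ : S₁ ∣ i ⊨ □ (team steady)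
      steady-S₁ = steady-updates ε o registers f-updates

      open Pair {S₁} {t′ = t′} ε S₁t S₁t′ enc act-t′
        (steady-forever {S₁} S₁t steady-S₁ dir-t)
        (steady-forever {S₁} S₁t′ steady-S₁ dir-t′)

    -- One trace is active now and the other at the next time, so neither fits into the inactive
    -- part and both land where the formula relates them.
    move-sound : ∀ {i t t′ q s} ε τ → τ ∈ₗ Γ → S t → S t′ → Encodes t i q s →
      Holds t′ (suc i) (lit act true) → S ∣ i ⊨ move ε τ → Successor i q s
    move-sound ε τ τ∈ St St′ enc act′ (S₁ , S₂ , (_ , S⊆) , f , g) with S⊆ St | S⊆ St′
    ... | inj₂ S₂t | _         =
      contradiction (proj₁ (team⇒Holds inactive g S₂t)) (not-¬ (active enc))
    ... | inj₁ _   | inj₂ S₂t′ =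
      contradiction (proj₂ (team⇒Holds inactive g S₂t′)) (not-¬ act′)
    ... | inj₁ S₁t | inj₁ S₁t′ = related-sound ε τ τ∈ St′ S₁t S₁t′ enc act′ f

    successor-sound : ∀ {i t q s} → S t → Encodes t i q s → S ∣ i ⊨ successor Γ → Successor i q s
    successor-sound {i} {t} St enc (lift incl , f) =
      let t′ , St′ , eqv      = incl _ St
          τ , τ∈ , ε , g      = moves-sound Γ St f
      in move-sound ε τ τ∈ St St′ enc
           (ltl⇒Holds (X (lit act true)) {t′}
             (Equivalence.to (eqv zero) (Holds⇒ltl (lit act true) {t} {i} (active enc)))) g

    -- The followed trace is always the one active at the current time, so when `stopped h` finally
    -- holds it must take the alternative that places it at `h`.
    until-sound : ∀ d {i t q s} → S t → Encodes t i q s →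
      S ∣ (d + i) ⊨ team (stopped h) →
      (∀ j → i ≤ j → j < d + i → S ∣ j ⊨ successor Γ) → ∃[ l ] Halts Γ h l q s
    until-sound zero {i} {t} {q} St enc f _ with team⇒Holds (stopped h) f St
    ... | inj₁ a = contradiction a (not-¬ (active enc))
    ... | inj₂ a with refl ← first-unique {t = t} {i} loc h q a (location enc) = 0 , halt
    until-sound (suc d) {i} St enc f steps
      with reached τ∈ g St′ enc′ ← successor-sound St enc (steps i ≤-refl (s≤s (m≤n+m i d))) =
      let l , r = until-sound d St′ enc′
            (subst (λ j → S ∣ j ⊨ team (stopped h)) (sym (+-suc d i)) f)
            (λ j i<j j< → steps j (<⇒≤ i<j) (subst (j <_) (+-suc d i) j<))
      in suc l , step τ∈ g r

-- The Kripke structure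

Traces-resp : ∀ {k s} {K : Kripke k s} {t t′} → (∀ i → t i ≡ t′ i) → Traces K t′ → Traces K t
Traces-resp eq (σ , path , labels) = σ , path , λ i → trans (eq i) (labels i)

module Universal (n : ℕ) where

  letter : Fin (2 ^ n) → Subset n
  letter w = tabulate (λ p → Inverse.to 2↔Bool (finToFun w p))

  index : Subset n → Fin (2 ^ n)
  index v = funToFin (λ p → Inverse.from 2↔Bool (lookup v p))

  letter-index : ∀ (v : Subset n) → letter (index v) ≡ v
  letter-index v = trans (tabulate-cong λ p →
      trans (cong (Inverse.to 2↔Bool) (finToFun-funToFin _ p)) (Inverse.strictlyInverseˡ 2↔Bool _))
    (tabulate∘lookup v)

  -- State zero is a trap marked by proposition zero; the other states carry
  -- the letters over the remaining propositions and form a complete graph.  The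
  -- trap makes it decidable which part of the initial split a trace belongs to.
  universal : Kripke (suc n) (suc (2 ^ n))
  universal = kripke (⁅ zero ⁆ ∷ replicate _ full) ((true ∷ ∅) ∷ tabulate (λ w → false ∷ letter w))
    (suc (index ∅))

  trapped : Trace (suc n)
  trapped zero    = ∅
  trapped (suc i) = true ∷ ∅

  unmarked : (ℕ → Subset n) → Trace (suc n)
  unmarked u zero    = ∅
  unmarked u (suc i) = false ∷ u i

  private
    label-index : ∀ (v : Subset n) → false ∷ v ≡ lookup (Kripke.label universal) (suc (index v))
    label-index v = sym (trans (lookup∘tabulate (λ w → false ∷ letter w) (index v))
                               (cong (false ∷_) (letter-index v)))

    full-successors : ∀ w {w′} → w′ ∈ lookup (Kripke.successors universal) (suc w)
    full-successors w {w′} = subst (w′ ∈_) (sym (lookup-replicate w full)) ∈⊤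

    labelled : ∀ {t : Trace (suc n)} (σ : ℕ → Fin (suc (2 ^ n))) →
      (∀ i → t i ≡ lookup (Kripke.label universal) (σ i)) →
      ∀ i {w} → σ i ≡ w → t i ≡ lookup (Kripke.label universal) w
    labelled σ labels i refl = labels i

  trapped∈Traces : Traces universal trapped
  trapped∈Traces = σ , (refl , edge) , labels
    where
    σ : ℕ → Fin (suc (2 ^ n))
    σ zero    = suc (index ∅)
    σ (suc i) = zero
    edge : ∀ i → σ (suc i) ∈ lookup (Kripke.successors universal) (σ i)
    edge zero    = full-successors (index ∅)
    edge (suc i) = x∈⁅x⁆ zero
    labels : ∀ i → trapped i ≡ lookup (Kripke.label universal) (σ i)
    labels zero    = label-index ∅
    labels (suc i) = refl

  unmarked∈Traces : ∀ u → Traces universal (unmarked u)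
  unmarked∈Traces u = (λ i → suc (σ i)) , (refl , λ i → full-successors (σ i)) , labels
    where
    σ : ℕ → Fin (2 ^ n)
    σ zero    = index ∅
    σ (suc i) = index (u i)
    labels : ∀ i → unmarked u i ≡ lookup (Kripke.label universal) (suc (σ i))
    labels zero    = label-index ∅
    labels (suc i) = label-index (u i)

  -- The second state of the path decides, since the trap has only a loop.
  trapped-or-unmarked : ∀ {t} → Traces universal t →
    (∀ i → t i ≡ trapped i) ⊎ lookup (t 1) zero ≡ false
  trapped-or-unmarked {t} (σ , (start , edge) , labels) with σ 1 in eq
  ... | suc w = inj₂ (cong (λ v → lookup v zero)
      (trans (labelled {t} σ labels 1 eq) (lookup∘tabulate (λ w → false ∷ letter w) w)))
  ... | zero  = inj₁ λ where
      zero    → trans (labelled {t} σ labels 0 start) (sym (label-index ∅))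
      (suc i) → labelled {t} σ labels (suc i) (stuck i)
    where
    stuck : ∀ i → σ (suc i) ≡ zero
    stuck zero    = eq
    stuck (suc i) = x∈⁅y⁆⇒x≡y zero
      (subst (λ w → σ (suc (suc i)) ∈ lookup (Kripke.successors universal) w) (stuck i)
        (edge (suc i)))

-- Teams of halting runs

data Move (Γ : List Transition) (q : ℕ) (s : State) : ℕ → State → Set where
  via : ∀ {o q′} → (q ─ o ⟶ q′) ∈ₗ Γ → Guard o s → Move Γ q s q′ (exec o s)

module _ {Γ : List Transition} {h : ℕ} where

  locations : ∀ {l q s} → Halts Γ h l q s → ℕ → ℕ
  -- Past its end the run repeats the halting configuration, which makes the sequence total.
  locations halt                 _       = h
  locations (step {q = q} _ _ _) zero    = q
  locations (step _ _ r)         (suc j) = locations r j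

  states : ∀ {l q s} → Halts Γ h l q s → ℕ → State
  states (halt {s = s})       _       = s
  states (step {s = s} _ _ _) zero    = s
  states (step _ _ r)         (suc j) = states r j

  locations-zero : ∀ {l q s} (r : Halts Γ h l q s) → locations r 0 ≡ q
  locations-zero halt         = refl
  locations-zero (step _ _ _) = refl

  states-zero : ∀ {l q s} (r : Halts Γ h l q s) → states r 0 ≡ s
  states-zero halt         = refl
  states-zero (step _ _ _) = refl

  locations-last : ∀ {l q s} (r : Halts Γ h l q s) → locations r l ≡ h
  locations-last halt         = refl
  locations-last (step _ _ r) = locations-last r

  halts-move : ∀ {l q s} (r : Halts Γ h l q s) {j} → j < l →
    Move Γ (locations r j) (states r j) (locations r (suc j)) (states r (suc j))
  halts-move (step τ∈ g r) {zero}  _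
    rewrite locations-zero r | states-zero r = via τ∈ g
  halts-move (step τ∈ g r) {suc j} (s≤s j<l) = halts-move r j<l

parity : ℕ → Bool
parity zero    = true
parity (suc j) = not (parity j)

module _ (m : ℕ) where
  open Encoding m
  open Universal (4 + m)

  zeroed⁺ : ∀ {t i} rs → Holds t i (lit act true) → Holds t i (lit loc true) →
    (∀ {r} → r ∈ₗ rs → Holds t i (lit (reg (suc r)) true)) →
    Holds t i (foldr (λ r φ → lit (reg (suc r)) true ∧ φ) (lit act true ∧ lit loc true) rs)
  zeroed⁺ []       a l z = a , l
  zeroed⁺ (r ∷ rs) a l z = z (here refl) , zeroed⁺ rs a l (z ∘ there)

  zeroed⁻ : ∀ {t i} rs →
    Holds t i (foldr (λ r φ → lit (reg (suc r)) true ∧ φ) (lit act true ∧ lit loc true) rs) →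
    Holds t i (lit act true) × Holds t i (lit loc true) ×
    (∀ {r} → r ∈ₗ rs → Holds t i (lit (reg (suc r)) true))
  zeroed⁻ []       (a , l) = a , l , λ ()
  zeroed⁻ (r ∷ rs) (z , f) =
    let a , l , zs = zeroed⁻ rs f in a , l , λ { (here refl) → z ; (there r∈) → zs r∈ }

  starting-encodes : ∀ {t i x} → Holds t i (starting x) → Encodes t i 0 (input x)
  starting-encodes {x = x} (f , g) =
    let a , l , zs = zeroed⁻ (upTo m) g
    in record
      { active   = a
      ; location = l
      ; register = λ { {zero} _ → f ; {suc r} (s≤s r<m) → zs (∈-upTo⁺ r<m) }
      }

  simulation-sound : ∀ Γ h x → (∀ {τ} → τ ∈ₗ Γ → Bounded (action τ)) →
    Traces universal ∣ 0 ⊨ simulation Γ h x → ∃[ l ] Halts Γ h l 0 (input x)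
  simulation-sound Γ h x bounded (S₁ , S₂ , (_ , S⊆) , (lift incl , (l , 2≤l , f , g)) , lift none)
    -- The trap carries `ini` at time one and so cannot lie in the second part; in the first it
    -- triggers the inclusion atom.
    with S⊆ trapped∈Traces
  ... | inj₂ S₂t = contradiction here (none trapped S₂t)
  ... | inj₁ S₁t =
    let t , St , eqv = incl trapped S₁t
    in until-sound (l ∸ 2) St
         (starting-encodes {t} {2} (ltl⇒Holds (starting x) {t} (Equivalence.to (eqv zero) here)))
         (subst (λ j → S₁ ∣ j ⊨ team (stopped h)) (sym (m∸n+n≡m 2≤l)) f)
         (λ j 2≤j j< → g j 2≤j (subst (j <_) (m∸n+n≡m 2≤l) j<))
    where open Soundness S₁ Γ h bounded

  -- The team built from a halting run

  module Completeness (Γ : List Transition) (h L : ℕ) (q : ℕ → ℕ) (s : ℕ → State)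
    (q-start : q 0 ≡ 0) (q-last : q L ≡ h)
    (moved : ∀ {j} → j < L → Move Γ (q j) (s j) (q (suc j)) (s (suc j)))
    (bounded : ∀ {τ} → τ ∈ₗ Γ → Bounded (action τ)) where

    -- Marks stand at absolute times: activation at `2 + j` plus the stored value. An unchanged
    -- value thus moves by one from each configuration to the next.
    content : ℕ → ℕ → Subset (4 + m)
    content j l =
      (l ≡ᵇ 2 + j) ∷ parity j ∷ (l ≡ᵇ (2 + j) + q j) ∷
      tabulate (λ r → l ≡ᵇ (2 + j) + s j (toℕ r))

    -- Trace zero is the trap; trace suc j encodes configuration j and is active
    -- at time 2 + j.
    run : ℕ → Trace (5 + m)
    run zero    = trapped
    run (suc j) = unmarked (content j ∘ suc)

    -- Membership is up to pointwise equality, as in `Traces`, and carries an index, so splits can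
    -- be decided on numbers instead of traces.
    Team : (ℕ → Set) → TraceSet (5 + m)
    Team P t = ∃[ n ] P n × (∀ i → t i ≡ run n i)

    Team⊨ : ∀ {P i} φ → (∀ {n} → P n → Holds (run n) i φ) → Team P ∣ i ⊨ team φ
    Team⊨ φ h = Holds⇒team φ λ _ (_ , Pn , eq) → Holds-resp φ eq (h Pn)

    reg-run : ∀ j {l r} → 2 + j ≤ l → r < suc m →
      lookup (run (suc j) l) (reg r) ≡ (l ≡ᵇ (2 + j) + s j r)
    reg-run j {suc l} (s≤s _) r<m =
      trans (lookup∘tabulate (λ r → suc l ≡ᵇ (2 + j) + s j (toℕ r)) _)
            (cong (λ r → suc l ≡ᵇ (2 + j) + s j r) (toℕ-clamp r<m))

    loc-run : ∀ j {l} → 2 + j ≤ l → lookup (run (suc j) l) loc ≡ (l ≡ᵇ (2 + j) + q j)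
    loc-run j (s≤s _) = refl

    active-run : ∀ j → lookup (run (suc j) (2 + j)) act ≡ true
    active-run j = ≡ᵇ-refl j

    inactive-run : ∀ n {l} → 1 < l → l ≢ suc n → lookup (run n l) act ≡ false
    inactive-run zero    (s≤s _) _  = refl
    inactive-run (suc j) (s≤s _) l≢ = ≢⇒≡ᵇ-false l≢

    location-run : ∀ j → Holds (run (suc j)) (2 + j) (first loc (q j))
    location-run j = first-single {t = run (suc j)} (2 + j) (q j) (loc-run j)

    register-run : ∀ j {r} → r < suc m → Holds (run (suc j)) (2 + j) (first (reg r) (s j r))
    register-run j {r} r<m =
      first-single {t = run (suc j)} (2 + j) (s j r) (λ 2+j≤l → reg-run j 2+j≤l r<m)

    Linked : ℕ → ℕ → Set
    Linked j n = n ≡ suc j ⊎ n ≡ 2 + j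

    module _ (j : ℕ) where

      linked : ∀ {l} φ → Holds (run (suc j)) l φ → Holds (run (2 + j)) l φ →
        Team (Linked j) ∣ l ⊨ team φ
      linked φ old new = Team⊨ φ λ { (inj₁ refl) → old ; (inj₂ refl) → new }

      steady-complete : Team (Linked j) ∣ 2 + j ⊨ □ (team steady)
      steady-complete = □⁺ (team steady) λ where
          (s≤s _) → linked steady (constant (parity j)) (constant (parity (suc j)))
        where
        constant : ∀ b → (b ≡ true × b ≡ true) ⊎ (b ≡ false × b ≡ false)
        constant true  = inj₁ (refl , refl)
        constant false = inj₂ (refl , refl)

      shift-complete : ∀ d {r r′} →
        (∀ {l} → 2 + j ≤ l →
          lookup (run (suc j) l) (reg r) ≡ lookup (run (2 + j) (d + l)) (reg r′)) →
        Team (Linked j) ∣ 2 + j ⊨ shift (parity j) d r r′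
      shift-complete d {r} {r′} eq = □⁺ (team (side true) ∨ᴮ team (side false)) choose
        where
        side = shifted (parity j) d r r′

        agree : ∀ {l} b → 2 + j ≤ l → lookup (run (suc j) l) (reg r) ≡ b →
          Team (Linked j) ∣ l ⊨ team (side b)
        agree {l} b 2+j≤l@(s≤s _) here≡b = linked (side b)
          (inj₁ (refl , here≡b))
          (inj₂ (refl , next⁺ d (lit (reg r′) b) {run (2 + j)} {l} (trans (sym (eq 2+j≤l)) here≡b)))

        choose : ∀ {l} → 2 + j ≤ l → Team (Linked j) ∣ l ⊨ (team (side true) ∨ᴮ team (side false))
        choose {l} 2+j≤l with lookup (run (suc j) l) (reg r) in here≡b
        ... | true  = inj₁ (agree true  2+j≤l here≡b)
        ... | false = inj₂ (agree false 2+j≤l here≡b)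

      update-complete : ∀ e {r} → InRange e → r < suc m → s (suc j) r ≡ value e (s j) →
        Team (Linked j) ∣ 2 + j ⊨ update (parity j) e r
      update-complete null {r} _ r<m eq = linked (lit act true ∨ X (lit (reg r) true))
        (inj₁ (active-run j))
        (inj₂ (subst (λ v → Holds (run (2 + j)) (3 + j) (first (reg r) v)) eq
          (register-run (suc j) r<m)))
      update-complete (copy r′) {r} r′<m r<m eq = shift-complete 1 λ {l} 2+j≤l →
        trans (reg-run j 2+j≤l r′<m)
          (trans (cong (λ v → suc l ≡ᵇ (3 + j) + v) (sym eq))
            (sym (reg-run (suc j) (s≤s 2+j≤l) r<m)))
      update-complete (incr r′) {r} r′<m r<m eq =
        linked (lit act true ∨ X (lit (reg r) false))
          (inj₁ (active-run j))
          (inj₂ (proj₁ (subst (λ v → Holds (run (2 + j)) (3 + j) (first (reg r) v)) eq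
            (register-run (suc j) r<m)))) ,
        shift-complete 2 λ {l} 2+j≤l →
          trans (reg-run j 2+j≤l r′<m)
            (trans (cong (l ≡ᵇ_) (sym (+-suc (suc j) (s j r′))))
              (trans (cong (λ v → 2 + l ≡ᵇ (3 + j) + v) (sym eq))
                (sym (reg-run (suc j) (m≤n⇒m≤1+n (s≤s 2+j≤l)) r<m))))

      updates-complete : ∀ o rs → (∀ {r} → r ∈ₗ rs → r < suc m) → Bounded o →
        s (suc j) ≡ exec o (s j) → Team (Linked j) ∣ 2 + j ⊨ updates (parity j) o rs
      updates-complete o []       _  _    _  = steady-complete
      updates-complete o (r ∷ rs) <m o-ok eq =
        update-complete (source o r) (source-inRange o o-ok (<m (here refl))) (<m (here refl))
          (cong (λ u → u r) eq) ,
        updates-complete o rs (<m ∘ there) o-ok eq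

      guard-complete : ∀ o → Bounded o → Guard o (s j) →
        Team (Linked j) ∣ 2 + j ⊨ guard (parity j) o
      guard-complete (_ ≔ _)    _   _ = steady-complete
      guard-complete (test r b) r<m g = linked (lit act false ∨ lit (reg r) b)
        (inj₂ (trans (first-zero {run (suc j)} {2 + j} (s j r) (register-run j r<m)) g))
        (inj₁ (inactive-run (2 + j) (s≤s (s≤s z≤n)) (<⇒≢ (n<1+n _))))
      guard-complete (r == r′) (r<m , r′<m) g = □⁺ (team (same (parity j) r r′)) λ {l} → λ where
          2+j≤l@(s≤s _) → linked (same (parity j) r r′)
            (inj₂ (agree (trans (reg-run j 2+j≤l r<m)
              (trans (cong (λ v → l ≡ᵇ (2 + j) + v) g) (sym (reg-run j 2+j≤l r′<m))))))
            (inj₁ refl)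
        where
        agree : ∀ {a b : Bool} → a ≡ b → (a ≡ true × b ≡ true) ⊎ (a ≡ false × b ≡ false)
        agree {true}  refl = inj₁ (refl , refl)
        agree {false} refl = inj₂ (refl , refl)

    -- Configurations after number `L` are included as well; they become active only after time
    -- `2 + L`, when the `U` formula is already fulfilled.
    Every : ℕ → Set
    Every _ = ⊤

    move-complete : ∀ j {o} → Bounded o → Guard o (s j) → s (suc j) ≡ exec o (s j) →
      Team Every ∣ 2 + j ⊨ move (parity j) (q j ─ o ⟶ q (suc j))
    move-complete j {o} o-ok g eq =
      Team (Linked j) , Team (λ n → ¬ Linked j n) , (union , split) ,
      (linked j (ends (parity j) (q j) (q (suc j)))
        (inj₁ ((active-run j , inactive-run (suc j) (s≤s (s≤s z≤n)) (<⇒≢ (n<1+n _) ∘ sym)) ,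
               refl , location-run j))
        (inj₂ ((inactive-run (2 + j) (s≤s (s≤s z≤n)) (<⇒≢ (n<1+n _)) , active-run (suc j)) ,
               refl , location-run (suc j))) ,
       guard-complete j o o-ok g , updates-complete j o registers ∈-upTo⁻ o-ok eq) ,
      Team⊨ inactive λ {n} ¬linked →
        inactive-run n (s≤s (s≤s z≤n)) (¬linked ∘ inj₁ ∘ sym ∘ suc-injective) ,
        inactive-run n (s≤s (s≤s z≤n)) (¬linked ∘ inj₂ ∘ sym ∘ suc-injective)
      where
      union : ∀ {t} → Team (Linked j) t ⊎ Team (λ n → ¬ Linked j n) t → Team Every t
      union (inj₁ (n , _ , eq)) = n , tt , eq
      union (inj₂ (n , _ , eq)) = n , tt , eq
      split : ∀ {t} → Team Every t → Team (Linked j) t ⊎ Team (λ n → ¬ Linked j n) t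
      split (n , _ , eq) with n ≟ suc j | n ≟ 2 + j
      ... | yes p | _     = inj₁ (n , inj₁ p , eq)
      ... | no _  | yes p = inj₁ (n , inj₂ p , eq)
      ... | no ¬p | no ¬r = inj₂ (n , [ ¬p , ¬r ]′ , eq)

    moves-complete : ∀ {S : TraceSet (5 + m)} {i τ} Δ → τ ∈ₗ Δ → ∀ ε →
      S ∣ i ⊨ move ε τ → S ∣ i ⊨ moves Δ
    moves-complete (_ ∷ _) (here refl) true  f = inj₁ (inj₁ f)
    moves-complete (_ ∷ _) (here refl) false f = inj₁ (inj₂ f)
    moves-complete (_ ∷ Δ) (there τ∈)  ε     f = inj₂ (moves-complete Δ τ∈ ε f)

    successor-complete : ∀ {j} → j < L → Team Every ∣ 2 + j ⊨ successor Γ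
    successor-complete {j} j<L = lift include , choose (moved j<L) refl refl
      where
      include : ∀ t → Team Every t → ∃[ t′ ] Team Every t′ × (∀ p → _ ⇔ _)
      include t (n , _ , eq) with n ≟ suc j
      ... | yes refl = run (2 + j) , (2 + j , tt , λ _ → refl) , λ where
        zero → mk⇔ (λ _ → Holds⇒ltl (lit act true) {run (2 + j)} {3 + j} (active-run (suc j)))
                   (λ _ → Holds⇒ltl (lit act true) {t} {2 + j}
                            (Holds-resp (lit act true) eq (active-run j)))
      -- An inactive trace needs a witness that is inactive at the next time, and the trap is never
      -- active.
      ... | no n≢ = trapped , (0 , tt , λ _ → refl) , λ where
        zero → mk⇔ (λ a → contradiction
                     (trans (sym (Holds-resp (lit act false) eq
                                   (inactive-run n (s≤s (s≤s z≤n)) (n≢ ∘ sym ∘ suc-injective))))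
                            (ltl⇒Holds (lit act true) {t} {2 + j} a)) λ ())
                   (λ a → contradiction (ltl⇒Holds (lit act true) {trapped} {3 + j} a) λ ())

      -- The targets become variables because matching on `via` cannot unify `exec o (s j)` with
      -- `s (suc j)`.
      choose : ∀ {q′ s′} → Move Γ (q j) (s j) q′ s′ → q′ ≡ q (suc j) → s′ ≡ s (suc j) →
        Team Every ∣ 2 + j ⊨ moves Γ
      choose (via τ∈ g) refl eq =
        moves-complete Γ τ∈ (parity j) (move-complete j (bounded τ∈) g (sym eq))

    stopped-complete : Team Every ∣ 2 + L ⊨ team (stopped h)
    stopped-complete = Team⊨ (stopped h) λ {n} _ → at n
      where
      at : ∀ n → Holds (run n) (2 + L) (stopped h)
      at n with n ≟ suc L
      ... | yes refl =
        inj₂ (subst (λ l → Holds (run (suc L)) (2 + L) (first loc l)) q-last (location-run L))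
      ... | no n≢    = inj₁ (inactive-run n (s≤s (s≤s z≤n)) (n≢ ∘ sym ∘ suc-injective))

    starting-complete : ∀ {x} → s 0 ≡ input x → Holds (run 1) 2 (starting x)
    starting-complete eq =
      subst (λ u → Holds (run 1) 2 (first (reg 0) (u 0))) eq (register-run 0 (s≤s z≤n)) ,
      zeroed⁺ (upTo m) refl
        (subst (λ l → Holds (run 1) 2 (first loc l)) q-start (location-run 0))
        (λ {r} r∈ → subst (λ u → Holds (run 1) 2 (first (reg (suc r)) (u (suc r)))) eq
                      (register-run 0 (s≤s (∈-upTo⁻ r∈))))

    simulation-complete : ∀ {x} → s 0 ≡ input x →
      Traces universal ∣ 0 ⊨ simulation Γ h x
    simulation-complete {x} s₀ =
      -- The parts overlap: the second omits only the trap, so it is never necessary to decide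
      -- whether a trace belongs to the run.
      Team Every , (λ t → Traces universal t × lookup (t 1) ini ≡ false) ,
      ([ included , proj₁ ]′ , cover) ,
      (lift include , (2 + L , s≤s (s≤s z≤n) , stopped-complete , steps)) ,
      lift (λ t (_ , no-ini) → Holds⇒ltl (lit ini false) {t} {1} no-ini)
      where
      included : ∀ {t} → Team Every t → Traces universal t
      included (zero  , _ , eq) = Traces-resp {K = universal} eq trapped∈Traces
      included (suc j , _ , eq) = Traces-resp {K = universal} eq (unmarked∈Traces _)

      cover : ∀ {t} → Traces universal t →
        Team Every t ⊎ (Traces universal t × lookup (t 1) ini ≡ false)
      cover T with trapped-or-unmarked T
      ... | inj₁ eq     = inj₁ (0 , tt , eq)
      ... | inj₂ no-ini = inj₂ (T , no-ini)

      include : ∀ t → Team Every t → ∃[ t′ ] Team Every t′ × (∀ p → _ ⇔ _)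
      include t (zero , _ , eq) = run 1 , (1 , tt , λ _ → refl) , λ where
        zero → mk⇔ (λ _ → Holds⇒ltl (starting x) {run 1} {2} (starting-complete s₀))
                   (λ _ → Holds⇒ltl (lit ini true) {t} {1} (Holds-resp (lit ini true) eq refl))
      -- Traces without `ini` need a witness violating `starting x`; the trap does, being inactive.
      include t (suc j , _ , eq) = trapped , (0 , tt , λ _ → refl) , λ where
        zero → mk⇔ (λ a → contradiction
                     (trans (sym (Holds-resp (lit ini false) eq refl))
                            (ltl⇒Holds (lit ini true) {t} {1} a)) λ ())
                   (λ a → contradiction
                     (Encodes.active (starting-encodes {trapped} {2} {x}
                       (ltl⇒Holds (starting x) {trapped} {2} a))) λ ())

      steps : ∀ j → 2 ≤ j → j < 2 + L → Team Every ∣ j ⊨ successor Γ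
      steps (suc (suc j)) (s≤s (s≤s _)) (s≤s (s≤s j<L)) = successor-complete j<L

-- Computability of the reduction

-- Only reads count: the formula describes each stored register through its source, and a register
-- that is never read need not be stored.
largest : Op → ℕ
largest (_ ≔ null)    = 0
largest (_ ≔ copy r)  = r
largest (_ ≔ incr r)  = r
largest (test r _)    = r
largest (r == r′)     = r ⊔ r′

largest-bounds : ∀ {m} o → largest o ≤ m → Encoding.Bounded m o
largest-bounds (_ ≔ null)   _   = tt
largest-bounds (_ ≔ copy r) r≤m = s≤s r≤m
largest-bounds (_ ≔ incr r) r≤m = s≤s r≤m
largest-bounds (test r _)   r≤m = s≤s r≤m
largest-bounds (r == r′)    ⊔≤m = s≤s (m⊔n≤o⇒m≤o r r′ ⊔≤m) , s≤s (m⊔n≤o⇒n≤o r r′ ⊔≤m)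

maximum : List Transition → ℕ
maximum = foldr (λ τ k → largest (action τ) ⊔ k) 0

≤-maximum : ∀ {Γ τ} → τ ∈ₗ Γ → largest (action τ) ≤ maximum Γ
≤-maximum (here refl)       = m≤m⊔n _ _
≤-maximum {τ′ ∷ Γ} (there τ∈) = ≤-trans (≤-maximum τ∈) (m≤n⊔m (largest (action τ′)) (maximum Γ))

comp₁ : ∀ {f : Rec 1} {g : Rec n} {xs y z} → g ⟦ xs ⟧⇓ y →
  f ⟦ y ∷ [] ⟧⇓ z → comp f (g ∷ []) ⟦ xs ⟧⇓ z
comp₁ d e = comp (λ { zero → d }) e

comp₂ : ∀ {f : Rec 2} {g h : Rec n} {xs y z w} → g ⟦ xs ⟧⇓ y → h ⟦ xs ⟧⇓ z →
  f ⟦ y ∷ z ∷ [] ⟧⇓ w → comp f (g ∷ h ∷ []) ⟦ xs ⟧⇓ w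
comp₂ d d′ e = comp (λ { zero → d ; (suc zero) → d′ }) e

numeral : ℕ → Rec n
numeral zero    = zer
numeral (suc k) = comp succ (numeral k ∷ [])

numeral⇓ : ∀ k {xs : Vec ℕ n} → numeral k ⟦ xs ⟧⇓ k
numeral⇓ zero    = zer
numeral⇓ (suc k) = comp₁ (numeral⇓ k) succ

double : Rec 1
double = prec zer (comp succ (comp succ (proj (suc zero) ∷ []) ∷ []))

double⇓ : ∀ x → double ⟦ x ∷ [] ⟧⇓ 2 * x
double⇓ zero    = prec₀ zer
double⇓ (suc x) = subst (double ⟦ suc x ∷ [] ⟧⇓_) (sym (*-suc 2 x))
  (precₛ (double⇓ x) (comp₁ (comp₁ (proj (suc zero)) succ) succ))

pair : Rec 2
pair = prec (comp succ (double ∷ [])) (comp double (proj (suc zero) ∷ []))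

pair⇓ : ∀ a b → pair ⟦ a ∷ b ∷ [] ⟧⇓ ⟨ a , b ⟩
pair⇓ zero    b = subst (pair ⟦ 0 ∷ b ∷ [] ⟧⇓_)
  (sym (trans (⟨,⟩-def 0 b) (*-identityˡ _)))
  (prec₀ (comp₁ (double⇓ b) succ))
pair⇓ (suc a) b = subst (pair ⟦ suc a ∷ b ∷ [] ⟧⇓_)
  (sym (trans (⟨,⟩-def (suc a) b) (trans (*-assoc 2 (2 ^ a) _) (cong (2 *_) (sym (⟨,⟩-def a b))))))
  (precₛ (pair⇓ a b) (comp₁ (proj (suc zero)) (double⇓ ⟨ a , b ⟩)))

Computable-id : Computable (λ x → x)
Computable-id = proj zero , λ x → proj zero

Computable-const : ∀ k → Computable (λ _ → k)
Computable-const k = numeral k , λ _ → numeral⇓ k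

Computable-⟨,⟩ : ∀ {f g} → Computable f → Computable g → Computable (λ x → ⟨ f x , g x ⟩)
Computable-⟨,⟩ (c , c⇓) (d , d⇓) = comp pair (c ∷ d ∷ []) , λ x → comp₂ (c⇓ x) (d⇓ x) (pair⇓ _ _)

Computable-iteration : ∀ {f g} → Computable g → (∀ x → f (suc x) ≡ g (f x)) → Computable f
Computable-iteration {f} {g} (c , c⇓) f-suc = e , e⇓
  where
  e : Rec 1
  e = prec (numeral (f 0)) (comp c (proj (suc zero) ∷ []))
  e⇓ : ∀ x → e ⟦ x ∷ [] ⟧⇓ f x
  e⇓ zero    = prec₀ (numeral⇓ (f 0))
  e⇓ (suc x) = subst (e ⟦ suc x ∷ [] ⟧⇓_) (sym (f-suc x))
    (precₛ (e⇓ x) (comp₁ (proj (suc zero)) (c⇓ (f x))))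

first-computable : ∀ {k} (p : Fin k) → Computable (λ n → ⌜ ltl (first p n) ⌝ᴸ)
first-computable p = Computable-iteration
  -- Each further step wraps the previous code in three constants: the tag of `∧`, the code of the
  -- negative literal and the tag of `X`.
  (Computable-⟨,⟩ (Computable-const _) (Computable-⟨,⟩ (Computable-const _)
    (Computable-⟨,⟩ (Computable-const _) Computable-id)))
  (λ _ → refl)

module Reduction (c : Rec 2) where

  Γ : List Transition
  Γ = code (search c) 0

  top : ℕ
  top = maximum Γ

  open Encoding top
  open Universal (4 + top)

  reduction : ℕ → Instance
  reduction x = inst (5 + top) (suc (2 ^ (4 + top))) (simulation Γ (exit (search c) 0) x) universal

  reduction-computable : Computable (λ x → ⌜ reduction x ⌝ᴵ)
  reduction-computable =
    -- The program, the Kripke structure and the rest of the formula depend on `c` alone; the input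
    -- enters only through `first (reg 0) x`.
    const ⟨⟩ const ⟨⟩ (const ⟨⟩ (const ⟨⟩ const ⟨⟩ inclusion ⟨⟩ const) ⟨⟩ const) ⟨⟩ const
    where
    infixr 5 _⟨⟩_
    _⟨⟩_ = Computable-⟨,⟩
    const : ∀ {k} → Computable (λ _ → k)
    const = Computable-const _
    start : Computable (λ x → ⌜ X (ltl (starting x)) ⌝ᴸ)
    start = const ⟨⟩ const ⟨⟩ first-computable (reg 0) ⟨⟩ const
    inclusion : Computable (λ x → ⌜ (atom ini ∷ []) ⊆ (X (ltl (starting x)) ∷ []) ⌝)
    inclusion = const ⟨⟩ const ⟨⟩ const ⟨⟩ start ⟨⟩ const

  bounded : ∀ {τ} → τ ∈ₗ Γ → Bounded (action τ)
  bounded {τ} τ∈ = largest-bounds (action τ) (≤-maximum τ∈)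

  reduction-correct : ∀ x → ModelChecking (reduction x) ⇔ (∃[ s ] ⟦ search c ⟧ (input x) s)
  reduction-correct x = mk⇔
    (λ f → Equivalence.to (halts⇔ (search c) (input x))
             (simulation-sound top Γ (exit (search c) 0) x bounded f))
    (λ p → complete (Equivalence.from (halts⇔ (search c) (input x)) p))
    where
    complete : ∃[ l ] Halts Γ (exit (search c) 0) l 0 (input x) → ModelChecking (reduction x)
    complete (l , r) =
      Completeness.simulation-complete top Γ (exit (search c) 0) l (locations r) (states r)
        (locations-zero r) (locations-last r) (halts-move r) bounded (states-zero r)

theorem2 : Σ⁰₁-Hard instanceNumbering ModelChecking
theorem2 A (χ , (c , computes) , A⇔) =
  reduction , reduction-computable , λ x →
  mk⇔ (λ a → let y , χxy = Equivalence.to (A⇔ x) a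
             in Equivalence.from (reduction-correct x) (search-complete χ c computes χxy))
      (λ f → let _ , p = Equivalence.to (reduction-correct x) f
             in Equivalence.from (A⇔ x) (search-sound χ c computes p))
  where open Reduction c
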